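{- Let $x$ be an indeterminate. For every $n\ge1$, the generating polynomial of rooted trees on $n$ labelled vertices enriched with set partitions, each block weighted with $x$, is $$\mathcal{A}_{e^{x(e^t-1)}}[n]=T_{n-1}(nx),$$ where $T_m(x)$ is the Touchard polynomial. In particular, the number of rooted trees on $n$ labelled vertices enriched with set partitions is $T_{n-1}(n)$.
   Context: The Touchard polynomials are defined by $\sum_{m\ge0}T_m(x)\frac{t^m}{m!}=e^{x(e^t-1)}$. A rooted tree enriched with set partitions is a (non-plane) rooted tree $T$ on the vertex set $\{1,\dots,n\}$ together with, for each vertex $v$, a set partition of the set $T^{ -1}(v)$ of children of $v$; its weight is $x$ raised to the total number of blocks of these partitions. $\mathcal{A}_{e^{x(e^t-1)}}[n]$ is the sum of the weights of all of these; equivalently, $\mathcal{A}_G(t)=\sum_{n\ge1}\mathcal{A}_G[n]\frac{t^n}{n!}$ is the solution of $\mathcal{A}_G(t)=t\,G(\mathcal{A}_G(t))$ with $G(t)=e^{x(e^t-1)}$. -}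

module Defs where

open import Data.Bool.Base using (true; false)
import Data.Bool.Properties as Bool
open import Data.Fin.Base as Fin using (Fin; zero; suc; toℕ)
import Data.Fin.Properties as Fin
open import Data.Fin.Subset using (Subset; Nonempty; Empty; inside; outside; _∩_; _∪_; ⋃)
import Data.Fin.Subset.Properties as Subset
open import Data.Integer.Base using (+_)
open import Data.List.Base as List using (List; []; _∷_; _++_; map; concatMap; length; upTo; allFin; foldr; filter; deduplicate)
open import Data.List.Membership.Propositional using (_∈_)
import Data.List.Membership.Propositional.Properties as Mem
import Data.List.Membership.DecPropositional as DecMem
open import Data.List.Membership.Propositional.Properties.WithK using (unique∧set⇒bag)
open import Data.List.Relation.Binary.BagAndSetEquality using (∼bag⇒↭)
open import Data.List.Relation.Binary.Permutation.Propositional as Perm using (_↭_; ↭-sym)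
open import Data.List.Relation.Binary.Permutation.Propositional.Properties using (All-resp-↭; ∈-resp-↭)
open import Data.List.Relation.Binary.Subset.Propositional using (_⊆_)
import Data.List.Relation.Binary.Subset.DecPropositional as DecSub
open import Data.List.Relation.Unary.All as All using (All; []; _∷_)
open import Data.List.Relation.Unary.AllPairs using (AllPairs; []; _∷_; allPairs?)
open import Data.List.Relation.Unary.Any as Any using (Any; here; there)
import Data.List.Relation.Unary.Any.Properties as Any
import Data.List.Relation.Unary.Enumerates.Setoid as Enumerates
import Data.List.Relation.Unary.Enumerates.Setoid.Properties as Enumerates
import Data.List.Relation.Unary.Unique.DecSetoid.Properties as UniqueDec
open import Data.List.Relation.Unary.Unique.Propositional using (Unique)
import Data.List.Relation.Unary.Unique.Propositional.Properties as Unique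
import Data.List.Relation.Unary.Unique.Setoid as UniqueSetoid
open import Data.Maybe.Base using (Maybe; just; nothing)
import Data.Maybe.Properties as Maybe
open import Data.Nat.Base using (ℕ; zero; suc; _∸_; _!; _≤_; _<_; s≤s)
open import Data.Nat.ListAction using (sum)
import Data.Nat.Properties as ℕ
open import Data.Product.Base using (∃; ∃-syntax; _×_; _,_; proj₁; proj₂)
open import Data.Rational.Base as ℚ using (ℚ; 0ℚ; 1ℚ; _/_)
open import Data.Sum.Base using (inj₁; inj₂)
open import Data.Vec.Base using ([]; _∷_; tabulate)
import Data.Vec.Properties as Vec
open import Function.Base using (_∘_; case_of_)
open import Function.Bundles using (mk⇔)
open import Level using (0ℓ)
open import Relation.Binary.Bundles using (Setoid; DecSetoid)
open import Relation.Binary.Construct.Closure.ReflexiveTransitive using (Star; ε; _◅_)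
open import Relation.Binary.Definitions using (DecidableEquality; Decidable; Symmetric)
open import Relation.Binary.PropositionalEquality using (_≡_; _≢_; _≗_; refl; sym; trans; cong; subst)
open import Relation.Nullary.Decidable using (Dec; yes; no; does; _×-dec_; map′; ¬?)
open import Relation.Nullary.Negation using (contradiction)

-- An element of ℚ[x] is the list of its coefficients, constant term first.
-- Trailing zeros are allowed, so elements are compared by _≈ₚ_.
Poly : Set
Poly = List ℚ

coeff : Poly → ℕ → ℚ
coeff []      _       = 0ℚ
coeff (a ∷ p) zero    = a
coeff (a ∷ p) (suc k) = coeff p k

infix 4 _≈ₚ_
_≈ₚ_ : Poly → Poly → Set
p ≈ₚ q = ∀ k → coeff p k ≡ coeff q k

const : ℚ → Poly
const a = a ∷ []

X : Poly
X = 0ℚ ∷ 1ℚ ∷ []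

infixl 6 _+ₚ_
_+ₚ_ : Poly → Poly → Poly
[]      +ₚ q       = q
(a ∷ p) +ₚ []      = a ∷ p
(a ∷ p) +ₚ (b ∷ q) = (a ℚ.+ b) ∷ (p +ₚ q)

infixl 7 _·ₚ_ _*ₚ_
_·ₚ_ : ℚ → Poly → Poly
a ·ₚ p = map (a ℚ.*_) p

_*ₚ_ : Poly → Poly → Poly
[]      *ₚ q = []
(a ∷ p) *ₚ q = (a ·ₚ q) +ₚ (0ℚ ∷ (p *ₚ q))

infixr 8 _^ₚ_
_^ₚ_ : Poly → ℕ → Poly
p ^ₚ zero  = const 1ℚ
p ^ₚ suc k = p *ₚ (p ^ₚ k)

sumₚ : List Poly → Poly
sumₚ = foldr _+ₚ_ []

-- p ∘ₚ q is the polynomial p(q(x)), by Horner's scheme.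
infixl 9 _∘ₚ_
_∘ₚ_ : Poly → Poly → Poly
[]      ∘ₚ q = []
(a ∷ p) ∘ₚ q = const a +ₚ q *ₚ (p ∘ₚ q)

eval : Poly → ℚ → ℚ
eval []      c = 0ℚ
eval (a ∷ p) c = a ℚ.+ c ℚ.* eval p c

fromℕ : ℕ → ℚ
fromℕ n = + n / 1

-- ℚ[x][[t]]: f m is the coefficient of tᵐ.
Series : Set
Series = ℕ → Poly

1ₛ : Series
1ₛ zero    = const 1ℚ
1ₛ (suc _) = []

infixl 6 _-ₛ_
_-ₛ_ : Series → Series → Series
(f -ₛ g) m = f m +ₚ (ℚ.- 1ℚ) ·ₚ g m

infixl 7 _·ₛ_ _*ₛ_
_·ₛ_ : Poly → Series → Series
(p ·ₛ f) m = p *ₚ f m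

_*ₛ_ : Series → Series → Series
(f *ₛ g) m = sumₚ (map (λ i → f i *ₚ g (m ∸ i)) (upTo (suc m)))

infixr 8 _^ₛ_
_^ₛ_ : Series → ℕ → Series
f ^ₛ zero  = 1ₛ
f ^ₛ suc k = f *ₛ (f ^ₛ k)

-- Composition g(f(t)) = Σₖ gₖ f(t)ᵏ, for f without constant term: then
-- f(t)ᵏ contributes to the coefficient of tᵐ only if k ≤ m.
infixl 9 _∘ₛ_
_∘ₛ_ : Series → Series → Series
(g ∘ₛ f) m = sumₚ (map (λ k → g k *ₚ (f ^ₛ k) m) (upTo (suc m)))

expₛ : Series
expₛ m = const (_/_ (+ 1) (m !) {{m ℕ.!≢0}})

-- e^(x(eᵗ-1)) = Σₘ Tₘ(x) tᵐ/m!
touchardEGF : Series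
touchardEGF = expₛ ∘ₛ (X ·ₛ (expₛ -ₛ 1ₛ))

touchard : ℕ → Poly
touchard m = fromℕ (m !) ·ₚ touchardEGF m

_≟ₛ_ : ∀ {n} → DecidableEquality (Subset n)
_≟ₛ_ = Vec.≡-dec Bool._≟_

Disjoint : ∀ {n} → Subset n → Subset n → Set
Disjoint B C = Empty (B ∩ C)

record IsPartition {n} (S : Subset n) (blocks : List (Subset n)) : Set where
  constructor mkIsPartition
  field
    nonempty : All Nonempty blocks
    disjoint : AllPairs Disjoint blocks
    covers   : ⋃ blocks ≡ S

SetPartition : ∀ {n} → Subset n → Set
SetPartition {n} S = ∃ (IsPartition {n} S)

-- Lists of blocks stand for sets of blocks: their order is irrelevant.
infix 4 _≋_
_≋_ : ∀ {n} → List (Subset n) → List (Subset n) → Set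
bs ≋ cs = bs ⊆ cs × cs ⊆ bs

-- A rooted tree on Fin n is given by its parent function, which is
-- undefined exactly at the root.
IsRootedTree : ∀ {n} → (Fin n → Maybe (Fin n)) → Set
IsRootedTree parent = ∃[ root ]
  parent root ≡ nothing × (∀ v → Star (λ u w → parent u ≡ just w) v root)

children : ∀ {n} → (Fin n → Maybe (Fin n)) → Fin n → Subset n
children parent v = tabulate λ u → does (Maybe.≡-dec Fin._≟_ (parent u) (just v))

record EnrichedTree (n : ℕ) : Set where
  constructor mkEnrichedTree
  field
    parent       : Fin n → Maybe (Fin n)
    isRootedTree : IsRootedTree parent
    partition    : ∀ v → SetPartition (children parent v)

  blocks : Fin n → List (Subset n)
  blocks v = proj₁ (partition v)

  numBlocks : ℕ
  numBlocks = sum (List.tabulate (length ∘ blocks))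

open EnrichedTree

infix 4 _≈ₜ_ _≈ₜ?_
_≈ₜ_ : ∀ {n} → EnrichedTree n → EnrichedTree n → Set
s ≈ₜ t = parent s ≗ parent t × (∀ v → blocks s v ≋ blocks t v)

_≈ₜ?_ : ∀ {n} → Decidable (_≈ₜ_ {n})
s ≈ₜ? t =
  Fin.all? (λ v → Maybe.≡-dec Fin._≟_ (parent s v) (parent t v)) ×-dec
  Fin.all? (λ v → (blocks s v ⊆? blocks t v) ×-dec (blocks t v ⊆? blocks s v))
  where open DecSub _≟ₛ_ using (_⊆?_)

enrichedTreeDecSetoid : ℕ → DecSetoid 0ℓ 0ℓ
enrichedTreeDecSetoid n = record
  { Carrier          = EnrichedTree n
  ; _≈_              = _≈ₜ_
  ; isDecEquivalence = record
    { isEquivalence = record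
      { refl  = (λ _ → refl) , λ _ → (λ x → x) , (λ x → x)
      ; sym   = λ (p , b) → (λ v → sym (p v)) , λ v → proj₂ (b v) , proj₁ (b v)
      ; trans = λ (p , b) (q , c) → (λ v → trans (p v) (q v)) ,
          λ v → (proj₁ (c v) ∘ proj₁ (b v)) , (proj₂ (b v) ∘ proj₂ (c v))
      }
    ; _≟_ = _≈ₜ?_
    }
  }

enrichedTreeSetoid : ℕ → Setoid 0ℓ 0ℓ
enrichedTreeSetoid n = DecSetoid.setoid (enrichedTreeDecSetoid n)

module _ {n} (parent : Fin n → Maybe (Fin n)) where

  -- r is reached from v in exactly k steps.
  Climb : ℕ → Fin n → Fin n → Set
  Climb zero    v r = v ≡ r
  Climb (suc k) v r = ∃[ w ] parent v ≡ just w × Climb k w r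

  climb? : ∀ k v r → Dec (Climb k v r)
  climb? zero    v r = v Fin.≟ r
  climb? (suc k) v r =
    Fin.any? λ w → Maybe.≡-dec Fin._≟_ (parent v) (just w) ×-dec climb? k w r

  fromStar : ∀ {v r} → Star (λ u w → parent u ≡ just w) v r → ∃[ k ] Climb k v r
  fromStar ε        = 0 , refl
  fromStar (e ◅ es) = let k , c = fromStar es in suc k , _ , e , c

  toStar : ∀ k {v r} → Climb k v r → Star (λ u w → parent u ≡ just w) v r
  toStar zero    refl        = ε
  toStar (suc k) (_ , e , c) = e ◅ toStar k c

  module _ {r} (root : parent r ≡ nothing) where

    climb-unique : ∀ k l {v} → Climb k v r → Climb l v r → k ≡ l
    climb-unique zero    zero    _    _ = refl
    climb-unique zero    (suc l) refl (_ , e , _) = contradiction (trans (sym root) e) λ ()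
    climb-unique (suc k) zero    (_ , e , _) refl = contradiction (trans (sym root) e) λ ()
    climb-unique (suc k) (suc l) (w , e , c) (w′ , e′ , c′)
      with refl ← Maybe.just-injective (trans (sym e) e′) = cong suc (climb-unique k l c c′)

    climb-suffix : ∀ k {v} → Climb k v r → ∀ i → i ≤ k → ∃[ u ] Climb i u r
    climb-suffix k c i i≤k with ℕ.m≤n⇒m<n∨m≡n i≤k
    climb-suffix k       c           i _ | inj₂ refl      = _ , c
    climb-suffix (suc k) (_ , _ , c) i _ | inj₁ (s≤s i≤k) = climb-suffix k c i i≤k

    climb-bound : ∀ k {v} → Climb k v r → k < n
    climb-bound k c = Fin.injective⇒≤ {f = f} λ {i} {j} fi≡fj → Fin.toℕ-injective
      (climb-unique (toℕ i) (toℕ j) (f-climb i)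
        (subst (λ u → Climb (toℕ j) u r) (sym fi≡fj) (f-climb j)))
      where
      at : (i : Fin (suc k)) → ∃[ u ] Climb (toℕ i) u r
      at i = climb-suffix k c (toℕ i) (ℕ.≤-pred (Fin.toℕ<n i))

      f : Fin (suc k) → Fin n
      f = proj₁ ∘ at

      f-climb : ∀ i → Climb (toℕ i) (f i) r
      f-climb = proj₂ ∘ at

    star? : ∀ v → Dec (Star (λ u w → parent u ≡ just w) v r)
    star? v = map′
      (λ (k , c) → toStar (toℕ k) c)
      (λ s → let k , c = fromStar s ; k<n = climb-bound k c in
        Fin.fromℕ< k<n , subst (λ j → Climb j v r) (sym (Fin.toℕ-fromℕ< k<n)) c)
      (Fin.any? λ k → climb? (toℕ k) v r)

  isRootedTree? : Dec (IsRootedTree parent)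
  isRootedTree? = Fin.any? λ r → dec r
    where
    dec : ∀ r → Dec (parent r ≡ nothing × (∀ v → Star (λ u w → parent u ≡ just w) v r))
    dec r with Maybe.≡-dec Fin._≟_ (parent r) nothing
    ... | no  ¬root = no (¬root ∘ proj₁)
    ... | yes root  = map′ (root ,_) proj₂ (Fin.all? (star? root))

isRootedTree-resp : ∀ {n} {p q : Fin n → Maybe (Fin n)} → p ≗ q → IsRootedTree p → IsRootedTree q
isRootedTree-resp p≗q (r , root , reach) =
  r , trans (sym (p≗q r)) root , λ v → go (reach v)
  where
  go : ∀ {v} → Star _ v r → Star _ v r
  go ε        = ε
  go (e ◅ es) = trans (sym (p≗q _)) e ◅ go es

isPartition? : ∀ {n} (S : Subset n) (bs : List (Subset n)) → Dec (IsPartition S bs)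
isPartition? S bs = map′
  (λ (a , b , c) → mkIsPartition a b c)
  (λ (mkIsPartition a b c) → a , b , c)
  (All.all? Subset.nonempty? bs ×-dec
   allPairs? (λ B C → ¬? (Subset.nonempty? (B ∩ C))) bs ×-dec
   ⋃ bs ≟ₛ S)

disjoint-sym : ∀ {n} → Symmetric (Disjoint {n})
disjoint-sym {x = B} {C} d ne = d (subst Nonempty (Subset.∩-comm C B) ne)

isPartition-resp : ∀ {n} {S : Subset n} {bs cs} → bs ↭ cs → IsPartition S bs → IsPartition S cs
isPartition-resp π (mkIsPartition ne d c) = mkIsPartition
  (All-resp-↭ π ne) (pairs π d) (trans (sym (⋃-resp π)) c)
  where
  ⋃-resp : ∀ {n} {bs cs : List (Subset n)} → bs ↭ cs → ⋃ bs ≡ ⋃ cs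
  ⋃-resp Perm.refl         = refl
  ⋃-resp (Perm.prep B π)   = cong (B ∪_) (⋃-resp π)
  ⋃-resp (Perm.swap {ys = ys} B C π) rewrite ⋃-resp π =
    trans (sym (Subset.∪-assoc B C _))
      (trans (cong (_∪ ⋃ ys) (Subset.∪-comm B C)) (Subset.∪-assoc C B _))
  ⋃-resp (Perm.trans π ρ)  = trans (⋃-resp π) (⋃-resp ρ)

  pairs : ∀ {n} {bs cs : List (Subset n)} → bs ↭ cs → AllPairs Disjoint bs → AllPairs Disjoint cs
  pairs Perm.refl        d = d
  pairs (Perm.prep _ π)  (b ∷ d) = All-resp-↭ π b ∷ pairs π d
  pairs (Perm.swap B C π) ((bc ∷ b) ∷ c ∷ d) =
    (disjoint-sym {x = B} {C} bc ∷ All-resp-↭ π c) ∷ All-resp-↭ π b ∷ pairs π d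
  pairs (Perm.trans π ρ) d = pairs ρ (pairs π d)

partition-unique : ∀ {n} {S : Subset n} {bs} → IsPartition S bs → Unique bs
partition-unique (mkIsPartition ne d _) = go ne d
  where
  differ : ∀ {n} {B C : Subset n} → Nonempty B → Disjoint B C → B ≢ C
  differ {B = B} neB d refl = d (subst Nonempty (sym (Subset.∩-idem B)) neB)

  go : ∀ {n} {bs : List (Subset n)} → All Nonempty bs → AllPairs Disjoint bs → Unique bs
  go []        []       = []
  go (ne ∷ nes) (d ∷ ds) = All.map (differ ne) d ∷ go nes ds

subsets : ∀ n → List (Subset n)
subsets zero    = [] ∷ []
subsets (suc n) = map (inside ∷_) (subsets n) ++ map (outside ∷_) (subsets n)

∈-subsets : ∀ {n} (S : Subset n) → S ∈ subsets n
∈-subsets []            = here refl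
∈-subsets (inside  ∷ S) = Mem.∈-++⁺ˡ (Mem.∈-map⁺ (inside ∷_) (∈-subsets S))
∈-subsets (outside ∷ S) = Mem.∈-++⁺ʳ _ (Mem.∈-map⁺ (outside ∷_) (∈-subsets S))

subsets-unique : ∀ n → Unique (subsets n)
subsets-unique zero    = [] ∷ []
subsets-unique (suc n) = Unique.++⁺
  (Unique.map⁺ Vec.∷-injectiveʳ (subsets-unique n))
  (Unique.map⁺ Vec.∷-injectiveʳ (subsets-unique n))
  λ (p , q) → case Mem.∈-map⁻ (inside ∷_) p of λ where
    (_ , _ , refl) → case Mem.∈-map⁻ (outside ∷_) q of λ where
      (_ , _ , ())

sublists : ∀ {A : Set} → List A → List (List A)
sublists []       = [] ∷ []
sublists (x ∷ xs) = map (x ∷_) (sublists xs) ++ sublists xs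

filter∈sublists : ∀ {A : Set} {P : A → Set} (P? : ∀ x → Dec (P x)) xs →
                  filter P? xs ∈ sublists xs
filter∈sublists P? []       = here refl
filter∈sublists P? (x ∷ xs) with does (P? x)
... | true  = Mem.∈-++⁺ˡ (Mem.∈-map⁺ (x ∷_) (filter∈sublists P? xs))
... | false = Mem.∈-++⁺ʳ _ (filter∈sublists P? xs)

select : ∀ {A : Set} {P : A → Set} → (∀ x → Dec (P x)) → List A → List (∃ P)
select P? []       = []
select P? (x ∷ xs) with P? x
... | yes px = (x , px) ∷ select P? xs
... | no  _  = select P? xs

∈-select : ∀ {A : Set} {P : A → Set} (P? : ∀ x → Dec (P x)) {Q : A → Set} {xs} →
           Any (λ x → P x × Q x) xs → Any (Q ∘ proj₁) (select P? xs)
∈-select P? {xs = x ∷ xs} (here (px , qx)) with P? x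
... | yes _  = here qx
... | no ¬px = contradiction px ¬px
∈-select P? {xs = x ∷ xs} (there w) with P? x
... | yes _ = there (∈-select P? w)
... | no  _ = ∈-select P? w

partitions : ∀ {n} (S : Subset n) → List (SetPartition S)
partitions {n} S = select (isPartition? S) (sublists (subsets n))

∈-partitions : ∀ {n} {S : Subset n} {bs} → IsPartition S bs →
               Any (λ π → bs ≋ proj₁ π) (partitions S)
∈-partitions {n} {S} {bs} p = ∈-select (isPartition? S) {Q = bs ≋_}
  (Any.map (λ { refl → isPartition-resp bs↭cs p , bs≋cs })
    (filter∈sublists (_∈? bs) (subsets n)))
  where
  open DecMem _≟ₛ_ using (_∈?_)

  cs : List (Subset n)
  cs = filter (_∈? bs) (subsets n)

  bs↭cs : bs ↭ cs
  bs↭cs = ∼bag⇒↭ (unique∧set⇒bag (partition-unique p)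
    (Unique.filter⁺ (_∈? bs) (subsets-unique n))
    (mk⇔ (λ B∈ → Mem.∈-filter⁺ (_∈? bs) (∈-subsets _) B∈)
         (λ B∈ → proj₂ (Mem.∈-filter⁻ (_∈? bs) {xs = subsets n} B∈))))

  bs≋cs : bs ≋ cs
  bs≋cs = ∈-resp-↭ bs↭cs , ∈-resp-↭ (↭-sym bs↭cs)

consΠ : ∀ {n} {A : Fin (suc n) → Set} → A zero → (∀ i → A (suc i)) → ∀ i → A i
consΠ a f zero    = a
consΠ a f (suc i) = f i

choices : ∀ {n} {A : Fin n → Set} → (∀ i → List (A i)) → List (∀ i → A i)
choices {zero}  xs = (λ ()) ∷ []
choices {suc n} xs = concatMap (λ a → map (consΠ a) (choices (xs ∘ suc))) (xs zero)

∈-choices : ∀ {n} {A : Fin n → Set} (xs : ∀ i → List (A i)) {Q : ∀ i → A i → Set} →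
            (∀ i → Any (Q i) (xs i)) → Any (λ f → ∀ i → Q i (f i)) (choices xs)
∈-choices {zero}  xs w = here λ ()
∈-choices {suc n} xs {Q} w = Any.concatMap⁺ _
  (Any.map (λ qa → Any.map⁺ (Any.map (λ qf → consΠ {A = λ i → Q i _} qa qf)
    (∈-choices (xs ∘ suc) (w ∘ suc)))) (w zero))

parentFunctions : ∀ n → List (Fin n → Maybe (Fin n))
parentFunctions n = choices λ _ → nothing ∷ map just (allFin n)

∈-parentFunctions : ∀ {n} (p : Fin n → Maybe (Fin n)) → Any (p ≗_) (parentFunctions n)
∈-parentFunctions {n} p = ∈-choices _ λ v → go (p v)
  where
  go : ∀ m → Any (m ≡_) (nothing ∷ map just (allFin n))
  go nothing  = here refl
  go (just w) = there (Mem.∈-map⁺ just (Mem.∈-allFin w))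

enrichments : ∀ {n} → ∃ (IsRootedTree {n}) → List (EnrichedTree n)
enrichments (p , t) = map (mkEnrichedTree p t) (choices λ v → partitions (children p v))

enrichedTreeCandidates : ∀ n → List (EnrichedTree n)
enrichedTreeCandidates n = concatMap enrichments (select isRootedTree? (parentFunctions n))

children-cong : ∀ {n} {p q : Fin n → Maybe (Fin n)} → p ≗ q → ∀ v → children p v ≡ children q v
children-cong p≗q v = Vec.tabulate-cong λ u →
  cong (λ m → does (Maybe.≡-dec Fin._≟_ m (just v))) (p≗q u)

candidates-complete : ∀ n → Enumerates.IsEnumeration (enrichedTreeSetoid n) (enrichedTreeCandidates n)
candidates-complete n t = Any.concatMap⁺ enrichments
  (Any.map (λ {x} → complete x)
    (∈-select isRootedTree?
      (Any.map (λ p≗q → isRootedTree-resp p≗q (isRootedTree t) , p≗q)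
        (∈-parentFunctions (parent t)))))
  where
  complete : ∀ (x : ∃ IsRootedTree) → parent t ≗ proj₁ x → Any (t ≈ₜ_) (enrichments x)
  complete (q , _) p≗q = Any.map⁺ (Any.map (p≗q ,_) (∈-choices _ λ v →
    ∈-partitions (subst (λ S → IsPartition S (blocks t v)) (children-cong p≗q v)
      (proj₂ (partition t v)))))

-- One representative of each class of _≈ₜ_, as shown by
-- enrichedTrees-complete and enrichedTrees-unique.
enrichedTrees : ∀ n → List (EnrichedTree n)
enrichedTrees n = deduplicate _≈ₜ?_ (enrichedTreeCandidates n)

enrichedTrees-complete : ∀ n → Enumerates.IsEnumeration (enrichedTreeSetoid n) (enrichedTrees n)
enrichedTrees-complete n = Enumerates.deduplicate⁺ (enrichedTreeDecSetoid n) (candidates-complete n)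

enrichedTrees-unique : ∀ n → UniqueSetoid.Unique (enrichedTreeSetoid n) (enrichedTrees n)
enrichedTrees-unique n = UniqueDec.deduplicate-! (enrichedTreeDecSetoid n) (enrichedTreeCandidates n)

𝒜[_] : ℕ → Poly
𝒜[ n ] = sumₚ (map (λ t → X ^ₚ numBlocks t) (enrichedTrees n))

{-# OPTIONS --safe #-}

-- All blocks of an enriched tree on n vertices together form a partition of
-- the n − 1 non-root vertices, and each block has a parent vertex, so that a
-- tree with k blocks is a root, a partition of the other vertices into k
-- blocks and an acyclic map from blocks to vertices. Contracting the blocks
-- one at a time shows that there are nᵏ⁻¹ such maps, whatever the partition,
-- hence nᵏ S(n − 1, k) trees with k blocks in total. On the other side,
-- (eᵗ − 1)ᵏ/k! is the generating function of S(m, k), because both satisfy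
-- the recurrence coming from ((eᵗ − 1)ᵏ)′ = k (eᵗ − 1)ᵏ + k (eᵗ − 1)ᵏ⁻¹;
-- so S(m, k) is the coefficient of xᵏ in Tₘ(x).
module Submission where

open import Data.Fin.Base using (Fin; zero; suc)
import Data.Fin.Properties as Fin
open import Data.Fin.Subset using (Subset; ⋃) renaming (_∈_ to _∈ₛ_)
import Data.Fin.Subset.Properties as Subset
import Data.Integer.Base as ℤ
import Data.Integer.Properties as ℤ
open import Data.List.Base as List using (List; []; _∷_; _++_; map; concatMap; length; allFin; upTo; applyUpTo; filter)
open import Data.List.Membership.Propositional using (_∈_; find; lose)
import Data.List.Membership.Propositional.Properties as Mem
open import Data.List.Membership.Propositional.Properties.WithK using (unique∧set⇒bag)
import Data.List.Properties as List
open import Data.List.Relation.Binary.BagAndSetEquality using (∼bag⇒↭)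
open import Data.List.Relation.Binary.Permutation.Propositional.Properties using (↭-length)
open import Data.List.Relation.Unary.All as All using ([]; _∷_)
import Data.List.Relation.Unary.All.Properties as All
open import Data.List.Relation.Unary.AllPairs as AllPairs using (AllPairs; []; _∷_)
import Data.List.Relation.Unary.AllPairs.Properties as AllPairs
open import Data.List.Relation.Unary.Any as Any using (Any; here; there)
import Data.List.Relation.Unary.Any.Properties as Any
open import Data.List.Relation.Unary.Unique.Propositional using (Unique)
import Data.List.Relation.Unary.Unique.Propositional.Properties as Unique
open import Data.Maybe.Base as Maybe using (Maybe; just; nothing)
import Data.Maybe.Properties as Maybe
open import Data.Nat.Base as ℕ using (ℕ; zero; suc; _∸_; _!; _<_; _≤_; s≤s; NonZero)
open import Data.Nat.ListAction using (sum)
import Data.Nat.Properties as ℕ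
open import Data.Nat.Tactic.RingSolver using (solve-∀)
open import Data.Product.Base using (∃; ∃-syntax; _×_; _,_; proj₁; proj₂)
import Data.Product.Properties as Product
open import Data.Rational.Base as ℚ using (ℚ; 0ℚ; 1ℚ; _/_; toℚᵘ; fromℚᵘ)
import Data.Rational.Properties as ℚ
open import Data.Rational.Solver using (module +-*-Solver)
open import Data.Rational.Unnormalised.Base as ℚᵘ using (mkℚᵘ; *≡*)
import Data.Rational.Unnormalised.Properties as ℚᵘ
open import Data.Sum.Base using (_⊎_; inj₁; inj₂)
open import Data.Vec.Base as Vec using (Vec; []; _∷_)
import Data.Vec.Properties as Vec
open import Function.Base using (_∘_; flip; case_of_)
open import Function.Bundles using (mk⇔)
open import Function.Definitions using (Injective)
open import Relation.Binary.Construct.Closure.ReflexiveTransitive using (Star; ε; _◅_)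
open import Relation.Binary.Definitions using (DecidableEquality)
open import Relation.Binary.PropositionalEquality using (_≡_; _≢_; _≗_; refl; sym; trans; cong; cong₂; subst; subst₂; module ≡-Reasoning)
open import Relation.Nullary.Decidable using (yes; no; does; dec-true)
open import Relation.Nullary.Negation using (¬_; contradiction)
open import Defs

-- Acyclic maps cannot be counted by induction for a single root: when the parent of the contracted
-- block is the root, the vertices of the block become roots too. The induction therefore allows any
-- number R of roots among N vertices, with R Nᵏ⁻¹ maps for k blocks, and the identity is multiplied
-- by N so that the exponent k - 1 does not occur at k = 0. For one root there are Nᵏ⁻¹ maps, and
-- the N choices of the root restore the factor Nᵏ, which is what replacing x by nx does to the
-- coefficient of xᵏ. `enrichedTrees` comes from a search followed by deduplication, and is used
-- only through its completeness and the absence of repetitions up to `_≈ₜ_`. Its trees are counted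
-- against a list of codes by two inequalities, both drawn from the relation `Encodes`. The blocks
-- of a code are numbered canonically, by restricted growth, since otherwise a tree with k blocks
-- would have k! codes.

module Counting where

  open import Data.Nat.Base using (_+_; _*_; _^_)
  open EnrichedTree

  private variable
    A B C V : Set
    k m n r : ℕ

  -- Counting with lists without repetition

  concatMap-unique : {f : A → List B} (key : B → A) →
                     (∀ x → Unique (f x)) → (∀ x {y} → y ∈ f x → key y ≡ x) →
                     ∀ {xs} → Unique xs → Unique (concatMap f xs)
  concatMap-unique key f! keyed [] = []
  concatMap-unique {f = f} key f! keyed {x ∷ xs} (x∉ ∷ xs!) =
    Unique.++⁺ (f! x) (concatMap-unique key f! keyed xs!) λ (y∈fx , y∈) →
      let x′ , x′∈ , y∈fx′ = find (Mem.∈-concatMap⁻ f {xs = xs} y∈)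
      in All.lookup x∉ x′∈ (trans (sym (keyed x y∈fx)) (keyed x′ y∈fx′))

  -- The factor `d` takes the place of a division: the number of acyclic maps is only known after
  -- multiplication by the number of vertices.
  length-concatMap-* : {f : A → List B} {c d : ℕ} → (∀ x → length (f x) * d ≡ c) →
                       ∀ xs → length (concatMap f xs) * d ≡ length xs * c
  length-concatMap-* len [] = refl
  length-concatMap-* {f = f} {d = d} len (x ∷ xs) = trans
    (trans (cong (_* d) (List.length-++ (f x))) (ℕ.*-distribʳ-+ d (length (f x)) _))
    (cong₂ _+_ (len x) (length-concatMap-* len xs))

  length-allFin : ∀ n → length (allFin n) ≡ n
  length-allFin n = List.length-tabulate {n = n} (λ i → i)

  AllPairs-lookup : {R : A → A → Set} {xs : List A} → AllPairs R xs →
                    ∀ i j → i ≢ j → R (List.lookup xs i) (List.lookup xs j) ⊎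
                                    R (List.lookup xs j) (List.lookup xs i)
  AllPairs-lookup (_ ∷ _)  zero    zero    i≢j = contradiction refl i≢j
  AllPairs-lookup {xs = _ ∷ xs} (p ∷ _)  zero    (suc j) _   = inj₁ (All.lookup p (Mem.∈-lookup {xs = xs} j))
  AllPairs-lookup {xs = _ ∷ xs} (p ∷ _)  (suc i) zero    _   = inj₂ (All.lookup p (Mem.∈-lookup {xs = xs} i))
  AllPairs-lookup (_ ∷ ps) (suc i) (suc j) i≢j = AllPairs-lookup ps i j (i≢j ∘ cong suc)

  -- A pigeonhole argument: totality gives each position of `xs` a related position of `ys`, and
  -- separation excludes that two positions share it. A relation replaces a function because trees
  -- matter only up to `_≈ₜ_`.
  length-≤ : (R : A → B → Set) {xs : List A} {ys : List B} →
             AllPairs (λ x x′ → ∀ y → R x y → ¬ R x′ y) xs →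
             (∀ {x} → x ∈ xs → Any (R x) ys) → length xs ≤ length ys
  length-≤ R {xs} {ys} sep total = Fin.injective⇒≤ {f = image} image-injective
    where
    related : ∀ i → Any (R (List.lookup xs i)) ys
    related i = total (Mem.∈-lookup {xs = xs} i)

    image : Fin (length xs) → Fin (length ys)
    image = Any.index ∘ related

    R-image : ∀ i → R (List.lookup xs i) (List.lookup ys (image i))
    R-image i = Any.lookup-index (related i)

    image-injective : Injective _≡_ _≡_ image
    image-injective {i} {j} eq with i Fin.≟ j
    ... | yes i≡j = i≡j
    ... | no  i≢j with AllPairs-lookup sep i j i≢j
    ... | inj₁ s = contradiction (subst (R _ ∘ List.lookup ys) (sym eq) (R-image j)) (s _ (R-image i))
    ... | inj₂ s = contradiction (subst (R _ ∘ List.lookup ys) eq (R-image i)) (s _ (R-image j))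

  -- Forests of blocks: o sends a vertex to its block, roots to nothing, and
  -- f sends a block to the parent shared by its vertices.

  contract : Maybe (Fin k) → Maybe (Fin (suc k)) → Maybe (Fin k)
  contract b nothing        = nothing
  contract b (just zero)    = b
  contract b (just (suc i)) = just i

  contract-suc : (b b′ : Maybe (Fin k)) → contract b (Maybe.map suc b′) ≡ b′
  contract-suc b nothing  = refl
  contract-suc b (just _) = refl

  -- The parent `v` of the first block must lie outside that block, which is what the form
  -- `Maybe.map suc b` expresses; the other blocks are judged after the first has been merged into
  -- the block of `v`, or into the roots. This form follows the recursion by which the maps are
  -- counted, whereas `Grounded` is the form that paths to the root of a tree provide.
  data Acyclic {V : Set} : (V → Maybe (Fin k)) → Vec V k → Set where
    []  : {o : V → Maybe (Fin 0)} → Acyclic o []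
    _∷_ : {o : V → Maybe (Fin (suc k))} {v : V} {f : Vec V k} {b : Maybe (Fin k)} →
          o v ≡ Maybe.map suc b → Acyclic (contract b ∘ o) f → Acyclic o (v ∷ f)

  data Grounded {V : Set} (o : V → Maybe (Fin k)) (f : Vec V k) (v : V) : Set where
    root : o v ≡ nothing → Grounded o f v
    step : ∀ {i} → o v ≡ just i → Grounded o f (Vec.lookup f i) → Grounded o f v

  Grounded-resp : {o : V → Maybe (Fin k)} {f : Vec V k} {u v : V} →
                  o u ≡ o v → Grounded o f v → Grounded o f u
  Grounded-resp eq (root e)   = root (trans eq e)
  Grounded-resp eq (step e g) = step (trans eq e) g

  module _ {o : V → Maybe (Fin (suc k))} {v : V} {f : Vec V k} {b : Maybe (Fin k)}
           (ov : o v ≡ Maybe.map suc b) where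

    private
      o′ : V → Maybe (Fin k)
      o′ = contract b ∘ o

      lift : ∀ {b′ u} → o u ≡ Maybe.map suc b′ → (∀ {i} → b′ ≡ just i → Grounded o (v ∷ f) (Vec.lookup f i)) →
             Grounded o (v ∷ f) u
      lift {nothing} e g = root e
      lift {just i}  e g = step e (g refl)

      uncontract : ∀ {u} → (∀ {i} → o′ u ≡ just i → Grounded o (v ∷ f) (Vec.lookup f i)) →
                   Grounded o (v ∷ f) u
      uncontract {u} g with o u in ou
      ... | nothing       = root ou
      -- A vertex of the merged block climbs to `v` first; the block of `v` is `b`, from where `g`
      -- continues.
      ... | just zero     = step ou (lift ov g)
      ... | just (suc i)  = step ou (g refl)

    contract⁻ : ∀ {u} → Grounded o′ f u → Grounded o (v ∷ f) u
    contract⁻ (root e)   = uncontract λ e′ → contradiction (trans (sym e) e′) λ ()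
    contract⁻ (step e g) = uncontract λ e′ →
      subst (Grounded o (v ∷ f) ∘ Vec.lookup f) (Maybe.just-injective (trans (sym e) e′)) (contract⁻ g)

    contract⁺ : ∀ {u} → Grounded o (v ∷ f) u → Grounded o′ f u
    contract⁺ (root e)               = root (cong (contract b) e)
    -- This step leads to `v`, which shares its block with `u` after the contraction, so the step is
    -- dropped.
    contract⁺ (step {zero}  e g)     = Grounded-resp
      (trans (cong (contract b) e) (sym (trans (cong (contract b) ov) (contract-suc b b)))) (contract⁺ g)
    contract⁺ (step {suc i} e g)     = step (cong (contract b) e) (contract⁺ g)

  acyclic⇒grounded : {o : V → Maybe (Fin k)} {f : Vec V k} → Acyclic o f → ∀ v → Grounded o f v
  acyclic⇒grounded {o = o} [] v with o v in ov
  ... | nothing = root ov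
  acyclic⇒grounded (e ∷ a) v = contract⁻ e (acyclic⇒grounded a v)

  -- Climbs are finite, but from a vertex `v` of the first block every step would lead back to `v`.
  grounded⇒¬loop : {o : V → Maybe (Fin (suc k))} {v : V} {f : Vec V k} →
                   Grounded o (v ∷ f) v → o v ≢ just zero
  grounded⇒¬loop (root e)           ov = contradiction (trans (sym e) ov) λ ()
  grounded⇒¬loop (step {zero}  e g) ov = grounded⇒¬loop g ov
  grounded⇒¬loop (step {suc _} e g) ov = contradiction (trans (sym e) ov) λ ()

  grounded⇒acyclic : {o : V → Maybe (Fin k)} {f : Vec V k} → (∀ v → Grounded o f v) → Acyclic o f
  grounded⇒acyclic {f = []}            g = []
  grounded⇒acyclic {o = o} {f = v ∷ f} g with o v in ov
  ... | nothing      = ov ∷ grounded⇒acyclic (contract⁺ {b = nothing} ov ∘ g)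
  ... | just zero    = contradiction ov (grounded⇒¬loop (g v))
  ... | just (suc i) = ov ∷ grounded⇒acyclic (contract⁺ {b = just i} ov ∘ g)

  -- Enumeration of the acyclic maps

  module _ (vs : List V) where

    mutual
      acyclics : (V → Maybe (Fin k)) → List (Vec V k)
      acyclics {zero}  o = [] ∷ []
      acyclics {suc k} o = concatMap (λ v → attach o v (o v)) vs

      -- The block of `v` is a separate argument so that it can be split on while `o` stays intact.
      attach : (V → Maybe (Fin (suc k))) → V → Maybe (Fin (suc k)) → List (Vec V (suc k))
      attach o v nothing        = map (v ∷_) (acyclics (contract nothing ∘ o))
      attach o v (just zero)    = []
      attach o v (just (suc i)) = map (v ∷_) (acyclics (contract (just i) ∘ o))

    mutual
      ∈-acyclics⁻ : (o : V → Maybe (Fin k)) {f : Vec V k} → f ∈ acyclics o → Acyclic o f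
      ∈-acyclics⁻ {zero}  o {[]} _  = []
      ∈-acyclics⁻ {suc k} o f∈ =
        let v , _ , f∈v = find (Mem.∈-concatMap⁻ (λ v → attach o v (o v)) {xs = vs} f∈)
        in ∈-attach⁻ o v (o v) refl f∈v

      ∈-attach⁻ : ∀ (o : V → Maybe (Fin (suc k))) v b {f} → o v ≡ b → f ∈ attach o v b → Acyclic o f
      ∈-attach⁻ o v nothing ov f∈ with _ , f′∈ , refl ← Mem.∈-map⁻ (v ∷_) f∈ =
        ov ∷ ∈-acyclics⁻ (contract nothing ∘ o) f′∈
      ∈-attach⁻ o v (just (suc i)) ov f∈ with _ , f′∈ , refl ← Mem.∈-map⁻ (v ∷_) f∈ =
        ov ∷ ∈-acyclics⁻ (contract (just i) ∘ o) f′∈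

    ∈-acyclics⁺ : (∀ v → v ∈ vs) → {o : V → Maybe (Fin k)} {f : Vec V k} → Acyclic o f → f ∈ acyclics o
    ∈-acyclics⁺ all [] = here refl
    ∈-acyclics⁺ all {o} (_∷_ {v = v} {b = b} ov a) =
      Mem.∈-concatMap⁺ (λ v → attach o v (o v)) {xs = vs}
        (Any.map (λ { refl → subst (λ b → _ ∈ attach o v b) (sym ov) (in-attach b (∈-acyclics⁺ all a)) }) (all v))
      where
      in-attach : ∀ b {f} → f ∈ acyclics (contract b ∘ o) → (v ∷ f) ∈ attach o v (Maybe.map suc b)
      in-attach nothing  = Mem.∈-map⁺ (v ∷_)
      in-attach (just _) = Mem.∈-map⁺ (v ∷_)

    attach-head : ∀ (o : V → Maybe (Fin (suc k))) v b {f} → f ∈ attach o v b → Vec.head f ≡ v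
    attach-head o v nothing        f∈ with _ , _ , refl ← Mem.∈-map⁻ (v ∷_) f∈ = refl
    attach-head o v (just (suc i)) f∈ with _ , _ , refl ← Mem.∈-map⁻ (v ∷_) f∈ = refl

    acyclics-unique : Unique vs → (o : V → Maybe (Fin k)) → Unique (acyclics o)
    acyclics-unique {zero}  vs! o = [] ∷ []
    acyclics-unique {suc k} vs! o = concatMap-unique Vec.head
      (λ v → attach-unique v (o v)) (λ v → attach-head o v (o v)) vs!
      where
      attach-unique : ∀ v b → Unique (attach o v b)
      attach-unique v nothing        = Unique.map⁺ Vec.∷-injectiveʳ (acyclics-unique vs! _)
      attach-unique v (just zero)    = []
      attach-unique v (just (suc i)) = Unique.map⁺ Vec.∷-injectiveʳ (acyclics-unique vs! _)

  -- The number of acyclic maps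

  rootCount : (V → Maybe A) → List V → ℕ
  rootCount o []       = 0
  rootCount o (v ∷ vs) with o v
  ... | nothing = suc (rootCount o vs)
  ... | just _  = rootCount o vs

  zeroCount sucCount : (V → Maybe (Fin (suc k))) → List V → ℕ
  zeroCount o []       = 0
  zeroCount o (v ∷ vs) with o v
  ... | just zero = suc (zeroCount o vs)
  ... | _         = zeroCount o vs
  sucCount o []       = 0
  sucCount o (v ∷ vs) with o v
  ... | just (suc _) = suc (sucCount o vs)
  ... | _            = sucCount o vs

  count-total : (o : V → Maybe (Fin (suc k))) (vs : List V) →
                rootCount o vs + zeroCount o vs + sucCount o vs ≡ length vs
  count-total o []       = refl
  count-total o (v ∷ vs) with o v | count-total o vs
  ... | nothing      | ih = cong suc ih
  ... | just zero    | ih = trans (cong (_+ sucCount o vs) (ℕ.+-suc _ _)) (cong suc ih)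
  ... | just (suc _) | ih = trans (ℕ.+-suc _ _) (cong suc ih)

  rootCount-contract-nothing : (o : V → Maybe (Fin (suc k))) (vs : List V) →
    rootCount (contract nothing ∘ o) vs ≡ rootCount o vs + zeroCount o vs
  rootCount-contract-nothing o []       = refl
  rootCount-contract-nothing o (v ∷ vs) with o v | rootCount-contract-nothing o vs
  ... | nothing      | ih = cong suc ih
  ... | just zero    | ih = trans (cong suc ih) (sym (ℕ.+-suc _ _))
  ... | just (suc _) | ih = ih

  rootCount-contract-just : (o : V → Maybe (Fin (suc k))) (i : Fin k) (vs : List V) →
    rootCount (contract (just i) ∘ o) vs ≡ rootCount o vs
  rootCount-contract-just o i []       = refl
  rootCount-contract-just o i (v ∷ vs) with o v | rootCount-contract-just o i vs
  ... | nothing      | ih = cong suc ih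
  ... | just zero    | ih = ih
  ... | just (suc _) | ih = ih

  -- Contracting the first block into the block (or the set of roots) that
  -- contains its parent leaves the number of vertices unchanged, so that
  -- the count depends on the number of roots only:
  -- with R roots and a first block of size Z, R (R + Z) + (N − R − Z) R = R N.
  length-acyclics : (vs : List V) (o : V → Maybe (Fin k)) →
    length (acyclics vs o) * length vs ≡ rootCount o vs * length vs ^ k
  length-acyclics {k = zero} vs o = trans (ℕ.*-identityˡ _) (sym (trans (ℕ.*-identityʳ _) (all-roots vs)))
    where
    all-roots : ∀ vs → rootCount o vs ≡ length vs
    all-roots []       = refl
    all-roots (v ∷ vs) with o v
    ... | nothing = cong suc (all-roots vs)
  length-acyclics {V = V} {k = suc k} vs o = begin
    length (acyclics vs o) * N                       ≡⟨ partial vs ⟩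
    R * ((R + Z) * N ^ k) + sucCount o vs * (R * N ^ k) ≡⟨ regroup R Z (sucCount o vs) (N ^ k) ⟩
    R * ((R + Z + sucCount o vs) * N ^ k)            ≡⟨ cong (λ x → R * (x * N ^ k)) (count-total o vs) ⟩
    R * N ^ suc k                                    ∎
    where
    open ≡-Reasoning

    N R Z : ℕ
    N = length vs
    R = rootCount o vs
    Z = zeroCount o vs

    regroup : ∀ r z s p → r * ((r + z) * p) + s * (r * p) ≡ r * ((r + z + s) * p)
    regroup = solve-∀

    length-nothing : ∀ v → length (attach vs o v nothing) * N ≡ (R + Z) * N ^ k
    length-nothing v = begin
      length (attach vs o v nothing) * N
        ≡⟨ cong (_* N) (List.length-map (v ∷_) (acyclics vs (contract nothing ∘ o))) ⟩
      length (acyclics vs (contract nothing ∘ o)) * N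
        ≡⟨ length-acyclics vs (contract nothing ∘ o) ⟩
      rootCount (contract nothing ∘ o) vs * N ^ k
        ≡⟨ cong (_* N ^ k) (rootCount-contract-nothing o vs) ⟩
      (R + Z) * N ^ k ∎

    length-just : ∀ v i → length (attach vs o v (just (suc i))) * N ≡ R * N ^ k
    length-just v i = begin
      length (attach vs o v (just (suc i))) * N
        ≡⟨ cong (_* N) (List.length-map (v ∷_) (acyclics vs (contract (just i) ∘ o))) ⟩
      length (acyclics vs (contract (just i) ∘ o)) * N
        ≡⟨ length-acyclics vs (contract (just i) ∘ o) ⟩
      rootCount (contract (just i) ∘ o) vs * N ^ k
        ≡⟨ cong (_* N ^ k) (rootCount-contract-just o i vs) ⟩
      R * N ^ k ∎

    split : ∀ (xs ys : List (Vec V (suc k))) → length (xs ++ ys) * N ≡ length xs * N + length ys * N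
    split xs ys = trans (cong (_* N) (List.length-++ xs)) (ℕ.*-distribʳ-+ N (length xs) (length ys))

    -- The induction runs over the candidates `us` for the parent of the first block, while the maps
    -- of the remaining blocks still take values in all of `vs`.
    partial : ∀ us → length (concatMap (λ v → attach vs o v (o v)) us) * N ≡
                     rootCount o us * ((R + Z) * N ^ k) + sucCount o us * (R * N ^ k)
    partial []       = refl
    partial (u ∷ us) with o u | partial us
    ... | nothing      | ih = trans (split (attach vs o u nothing) _)
      (trans (cong₂ _+_ (length-nothing u) ih) (sym (ℕ.+-assoc ((R + Z) * N ^ k) _ _)))
    ... | just zero    | ih = ih
    ... | just (suc i) | ih = trans (split (attach vs o u (just (suc i))) _)
      (trans (cong₂ _+_ (length-just u i) ih) (swap (R * N ^ k) (rootCount o us * ((R + Z) * N ^ k)) _))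
      where
      swap : ∀ a b c → a + (b + c) ≡ b + (a + c)
      swap = solve-∀

  -- Set partitions

  -- Partitions into k blocks of the complement of an r-element subset of
  -- Fin m, as restricted growth functions: each element is excluded, starts
  -- a new block, or joins an existing block of the remaining elements.
  data Part : ℕ → ℕ → ℕ → Set where
    empty : Part 0 0 0
    skip  : Part r m k → Part (suc r) (suc m) k
    new   : Part r m k → Part r (suc m) (suc k)
    old   : Fin k → Part r m k → Part r (suc m) k

  owner : Part r m k → Fin m → Maybe (Fin k)
  owner (skip ρ)  zero    = nothing
  owner (skip ρ)  (suc u) = owner ρ u
  owner (new ρ)   zero    = just zero
  owner (new ρ)   (suc u) = Maybe.map suc (owner ρ u)
  owner (old i ρ) zero    = just i
  owner (old i ρ) (suc u) = owner ρ u

  owner-surjective : (ρ : Part r m k) (i : Fin k) → ∃[ u ] owner ρ u ≡ just i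
  owner-surjective (skip ρ)  i       = let u , e = owner-surjective ρ i in suc u , e
  owner-surjective (new ρ)   zero    = zero , refl
  owner-surjective (new ρ)   (suc i) = let u , e = owner-surjective ρ i in suc u , cong (Maybe.map suc) e
  owner-surjective (old _ ρ) i       = let u , e = owner-surjective ρ i in suc u , e

  map-nothing : {f : A → B} {x : Maybe A} → Maybe.map f x ≡ nothing → x ≡ nothing
  map-nothing {x = nothing} _ = refl

  owner-total : (ρ : Part 0 m k) (u : Fin m) → owner ρ u ≢ nothing
  owner-total (new ρ)   (suc u) e = owner-total ρ u (map-nothing e)
  owner-total (old _ ρ) (suc u) e = owner-total ρ u e

  owner-root : (ρ : Part 1 m k) → ∃[ u ] owner ρ u ≡ nothing
  owner-root (skip ρ)  = zero , refl
  owner-root (new ρ)   = let u , e = owner-root ρ in suc u , cong (Maybe.map suc) e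
  owner-root (old _ ρ) = let u , e = owner-root ρ in suc u , e

  owner-root-unique : (ρ : Part 1 m k) {u v : Fin m} → owner ρ u ≡ nothing → owner ρ v ≡ nothing → u ≡ v
  owner-root-unique (skip ρ)  {zero}  {zero}  p q = refl
  owner-root-unique (skip ρ)  {zero}  {suc v} p q = contradiction q (owner-total ρ v)
  owner-root-unique (skip ρ)  {suc u}         p q = contradiction p (owner-total ρ u)
  owner-root-unique (new ρ)   {suc u} {suc v} p q = cong suc (owner-root-unique ρ (map-nothing p) (map-nothing q))
  owner-root-unique (old _ ρ) {suc u} {suc v} p q = cong suc (owner-root-unique ρ p q)

  roots≡0 : (ρ : Part r m k) → (∀ u → owner ρ u ≢ nothing) → r ≡ 0
  roots≡0 empty     _  = refl
  roots≡0 (skip ρ)  tot = contradiction refl (tot zero)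
  roots≡0 (new ρ)   tot = roots≡0 ρ λ u e → tot (suc u) (cong (Maybe.map suc) e)
  roots≡0 (old _ ρ) tot = roots≡0 ρ (tot ∘ suc)

  -- `factorise` provides the number `r` of excluded elements only existentially; for a tree, the
  -- uniqueness of the root identifies it.
  roots≡1 : (ρ : Part r m k) {v : Fin m} → owner ρ v ≡ nothing →
            (∀ u → owner ρ u ≡ nothing → u ≡ v) → r ≡ 1
  roots≡1 (skip ρ) {zero}   e uniq = cong suc (roots≡0 ρ λ u eu → contradiction (uniq (suc u) eu) λ ())
  roots≡1 (skip ρ) {suc v}  e uniq = contradiction (uniq zero refl) λ ()
  roots≡1 (new ρ) {suc v}   e uniq = roots≡1 ρ (map-nothing e)
    λ u eu → Fin.suc-injective (uniq (suc u) (cong (Maybe.map suc) eu))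
  roots≡1 (old _ ρ) {suc v} e uniq = roots≡1 ρ e λ u eu → Fin.suc-injective (uniq (suc u) eu)

  rootCount-tabulate : (o : V → Maybe A) (f : Fin n → V) →
                       rootCount o (List.tabulate f) ≡ rootCount (o ∘ f) (allFin n)
  rootCount-tabulate {n = zero}  o f = refl
  rootCount-tabulate {n = suc n} o f with o (f zero)
  ... | nothing = cong suc (trans (rootCount-tabulate o (f ∘ suc)) (sym (rootCount-tabulate (o ∘ f) suc)))
  ... | just _  = trans (rootCount-tabulate o (f ∘ suc)) (sym (rootCount-tabulate (o ∘ f) suc))

  rootCount-map : (o : V → Maybe A) (g : A → B) (vs : List V) →
                  rootCount (Maybe.map g ∘ o) vs ≡ rootCount o vs
  rootCount-map o g []       = refl
  rootCount-map o g (v ∷ vs) with o v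
  ... | nothing = cong suc (rootCount-map o g vs)
  ... | just _  = rootCount-map o g vs

  rootCount-owner : (ρ : Part r m k) → rootCount (owner ρ) (allFin m) ≡ r
  rootCount-owner empty = refl
  rootCount-owner ρ@(skip ρ′)  = cong suc (trans (rootCount-tabulate (owner ρ) suc) (rootCount-owner ρ′))
  rootCount-owner ρ@(new ρ′)   = trans (rootCount-tabulate (owner ρ) suc)
    (trans (rootCount-map (owner ρ′) suc (allFin _)) (rootCount-owner ρ′))
  rootCount-owner ρ@(old _ ρ′) = trans (rootCount-tabulate (owner ρ) suc) (rootCount-owner ρ′)

  -- Enumeration of the partitions

  mutual
    parts : ∀ r m k → List (Part r m k)
    parts zero    zero    zero    = empty ∷ []
    parts zero    zero    (suc k) = []
    parts (suc r) zero    k       = []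
    parts r       (suc m) k       = skips r m k ++ news r m k ++ olds r m k

    skips news olds : ∀ r m k → List (Part r (suc m) k)
    skips zero    m k = []
    skips (suc r) m k = map skip (parts r m k)
    news r m zero    = []
    news r m (suc k) = map new (parts r m k)
    olds r m k = concatMap (λ i → map (old i) (parts r m k)) (allFin k)

  ∈-parts : (ρ : Part r m k) → ρ ∈ parts r m k
  ∈-parts empty = here refl
  ∈-parts (skip ρ) = Mem.∈-++⁺ˡ (Mem.∈-map⁺ skip (∈-parts ρ))
  ∈-parts {suc r} {suc m} {suc k} (new ρ) = Mem.∈-++⁺ʳ (skips (suc r) m (suc k)) (Mem.∈-++⁺ˡ (Mem.∈-map⁺ new (∈-parts ρ)))
  ∈-parts {zero}  {suc m} {suc k} (new ρ) = Mem.∈-++⁺ˡ (Mem.∈-map⁺ new (∈-parts ρ))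
  ∈-parts {r} {suc m} {k} (old i ρ) = go r (∈-parts ρ)
    where
    member : ∀ r {ρ : Part r m k} → ρ ∈ parts r m k → old i ρ ∈ olds r m k
    member r {ρ} ρ∈ = Mem.∈-concatMap⁺ (λ i → map (old i) (parts r m k))
      (Any.map (λ { refl → Mem.∈-map⁺ (old i) ρ∈ }) (Mem.∈-allFin i))

    -- `parts r (suc m) k` reduces only once `r` is a constructor, hence the split.
    go : ∀ r {ρ : Part r m k} → ρ ∈ parts r m k → old i ρ ∈ parts r (suc m) k
    go zero    ρ∈ = Mem.∈-++⁺ʳ (skips zero m k) (Mem.∈-++⁺ʳ (news zero m k) (member zero ρ∈))
    go (suc r) ρ∈ = Mem.∈-++⁺ʳ (skips (suc r) m k) (Mem.∈-++⁺ʳ (news (suc r) m k) (member (suc r) ρ∈))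

  -- An invariant that tells the three sublists of `parts` apart, from which it follows that they do
  -- not overlap.
  tag : Part r (suc m) k → ℕ
  tag (skip _)  = 0
  tag (new _)   = 1
  tag (old _ _) = 2

  tag-skips : ∀ r {ρ : Part r (suc m) k} → ρ ∈ skips r m k → tag ρ ≡ 0
  tag-skips (suc r) ρ∈ with _ , _ , refl ← Mem.∈-map⁻ skip ρ∈ = refl

  tag-news : ∀ k {ρ : Part r (suc m) k} → ρ ∈ news r m k → tag ρ ≡ 1
  tag-news (suc k) ρ∈ with _ , _ , refl ← Mem.∈-map⁻ new ρ∈ = refl

  tag-olds : ∀ r {ρ : Part r (suc m) k} → ρ ∈ olds r m k → tag ρ ≡ 2
  tag-olds {m} {k} r ρ∈
    with i , _ , ρ∈i ← find (Mem.∈-concatMap⁻ (λ i → map (old i) (parts r m k)) {xs = allFin k} ρ∈)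
    with _ , _ , refl ← Mem.∈-map⁻ (old i) ρ∈i = refl

  parts-unique : ∀ r m k → Unique (parts r m k)
  parts-unique zero    zero    zero    = [] ∷ []
  parts-unique zero    zero    (suc k) = []
  parts-unique (suc r) zero    k       = []
  parts-unique r       (suc m) k       = go r
    where
    news-unique : ∀ r k → Unique (news r m k)
    news-unique r zero    = []
    news-unique r (suc k) = Unique.map⁺ (λ { refl → refl }) (parts-unique r m k)

    olds-unique : ∀ r k → Unique (olds r m k)
    olds-unique r zero = []
    -- The key is the block that element zero joins. The default `zero` requires a positive `k`,
    -- hence the separate case; on elements of the form `old i ρ` the key is `i`.
    olds-unique r k@(suc _) = concatMap-unique (λ ρ → Maybe.fromMaybe zero (owner ρ zero))
      (λ i → Unique.map⁺ (λ { refl → refl }) (parts-unique r m k))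
      (λ i ρ∈ → case Mem.∈-map⁻ (old i) ρ∈ of λ { (_ , _ , refl) → refl })
      (Unique.allFin⁺ k)

    rest-unique : ∀ r → Unique (news r m k ++ olds r m k)
    rest-unique r = Unique.++⁺ (news-unique r k) (olds-unique r k)
      λ (p , q) → contradiction (trans (sym (tag-news k p)) (tag-olds r q)) λ ()

    skip∉rest : ∀ r {ρ} → ρ ∈ news r m k ++ olds r m k → tag ρ ≢ 0
    skip∉rest r ρ∈ e with Mem.∈-++⁻ (news r m k) ρ∈
    ... | inj₁ p = contradiction (trans (sym e) (tag-news k p)) λ ()
    ... | inj₂ q = contradiction (trans (sym e) (tag-olds r q)) λ ()

    go : ∀ r → Unique (parts r (suc m) k)
    go zero    = rest-unique zero
    go (suc r) = Unique.++⁺ (Unique.map⁺ (λ { refl → refl }) (parts-unique r m k)) (rest-unique (suc r))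
      λ (p , q) → skip∉rest (suc r) q (tag-skips (suc r) p)

  -- Stirling numbers of the second kind

  stirling : ℕ → ℕ → ℕ
  stirling zero    zero    = 1
  stirling zero    (suc k) = 0
  stirling (suc m) zero    = 0
  stirling (suc m) (suc k) = stirling m k + suc k * stirling m (suc k)

  length-olds : ∀ r m k → length (olds r m k) ≡ k * length (parts r m k)
  length-olds r m k = begin
    length (olds r m k)                      ≡⟨ ℕ.*-identityʳ _ ⟨
    length (olds r m k) * 1                  ≡⟨ length-concatMap-* len (allFin k) ⟩
    length (allFin k) * length (parts r m k) ≡⟨ cong (_* length (parts r m k)) (length-allFin k) ⟩
    k * length (parts r m k)                 ∎
    where
    open ≡-Reasoning

    len : ∀ i → length (map (old i) (parts r m k)) * 1 ≡ length (parts r m k)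
    len i = trans (ℕ.*-identityʳ _) (List.length-map (old i) (parts r m k))

  length-parts₀ : ∀ m k → length (parts 0 m k) ≡ stirling m k
  length-parts₀ zero    zero    = refl
  length-parts₀ zero    (suc k) = refl
  length-parts₀ (suc m) zero    = refl
  length-parts₀ (suc m) (suc k) = trans (List.length-++ (news 0 m (suc k)))
    (cong₂ _+_ (trans (List.length-map new (parts 0 m k)) (length-parts₀ m k))
      (trans (length-olds 0 m (suc k)) (cong (suc k *_) (length-parts₀ m (suc k)))))

  -- Any of the `suc m` elements can be the excluded one, and the other `m` are then partitioned
  -- freely. If it is element zero, `skips` contributes S(m, k); by induction, `rest` contributes m
  -- S(m, k).
  length-parts₁ : ∀ m k → length (parts 1 (suc m) k) ≡ suc m * stirling m k
  length-parts₁ m k = trans (List.length-++ (skips 1 m k))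
    (cong₂ _+_ (trans (List.length-map skip (parts 0 m k)) (length-parts₀ m k))
               (trans (List.length-++ (news 1 m k)) (rest m k)))
    where
    regroup : ∀ m s k s′ → m * s + (1 + k) * (m * s′) ≡ m * (s + (1 + k) * s′)
    regroup = solve-∀

    rest : ∀ m k → length (news 1 m k) + length (olds 1 m k) ≡ m * stirling m k
    rest zero    zero    = refl
    rest zero    (suc k) = trans (length-olds 1 0 (suc k)) (ℕ.*-zeroʳ (suc k))
    rest (suc m) zero    = sym (ℕ.*-zeroʳ (suc m))
    rest (suc m) (suc k) = trans
      (cong₂ _+_ (trans (List.length-map new (parts 1 (suc m) k)) (length-parts₁ m k))
                 (trans (length-olds 1 (suc m) (suc k)) (cong (suc k *_) (length-parts₁ m (suc k)))))
      (regroup (suc m) (stirling m k) k (stirling m (suc k)))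

  -- Canonical numbering of the values of a partial function

  cons : A → (Fin k → A) → Fin (suc k) → A
  cons a g zero    = a
  cons a g (suc i) = g i

  -- The values of `c` are numbered from the last element towards the first: a value not met before
  -- takes the number zero and shifts the others up, and `g` lists the values met. This turns blocks
  -- given as subsets into the numbered blocks of a `Part`.
  factorise : DecidableEquality C → (c : Fin m → Maybe C) →
              ∃[ r ] ∃[ k ] ∃[ ρ ] ∃[ g ] Injective _≡_ _≡_ g × (∀ u → c u ≡ Maybe.map g (owner {r} {m} {k} ρ u))
  factorise {m = zero}  _≟_ c = 0 , 0 , empty , (λ ()) , (λ { {()} }) , λ ()
  factorise {C = C} {m = suc m} _≟_ c
    with r , k , ρ , g , g-inj , eq ← factorise _≟_ (c ∘ suc) | c zero in c0
  ... | nothing = suc r , k , skip ρ , g , g-inj , λ { zero → c0 ; (suc u) → eq u }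
  ... | just x with Fin.any? (λ i → g i ≟ x)
  ... | yes (i , refl) = r , k , old i ρ , g , g-inj , λ { zero → c0 ; (suc u) → eq u }
  ... | no x∉g = r , suc k , new ρ , cons x g , inj , λ { zero → c0 ; (suc u) → trans (eq u) (Maybe.map-∘ (owner ρ u)) }
    where
    inj : Injective _≡_ _≡_ (cons x g)
    inj {zero}  {zero}  _ = refl
    inj {zero}  {suc j} e = contradiction (j , sym e) x∉g
    inj {suc i} {zero}  e = contradiction (i , e) x∉g
    inj {suc i} {suc j} e = cong suc (g-inj e)

  -- On the right, the block `j` joined by element zero also contains a later element `u`, by
  -- surjectivity. On the left, element zero is alone in its block, and since `g` is injective `u`
  -- cannot share its value.
  new≢old : (ρ : Part r m k) (ρ′ : Part r m (suc k)) {g g′ : Fin (suc k) → C} (j : Fin (suc k)) →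
            Injective _≡_ _≡_ g → ¬ (∀ u → Maybe.map g (owner (new ρ) u) ≡ Maybe.map g′ (owner (old j ρ′) u))
  new≢old ρ ρ′ {g} {g′} j g-inj eq with u , e ← owner-surjective ρ′ j
    with owner ρ u | trans (eq (suc u)) (trans (cong (Maybe.map g′) e) (sym (eq zero)))
  ... | nothing | ()
  ... | just i  | e′ with () ← g-inj (Maybe.just-injective e′)

  -- The values determine each constructor: an element is excluded, has a value that no later
  -- element has, or has a value that occurs later. The numbering of the values is then forced as
  -- well.
  factorise-unique : (ρ ρ′ : Part r m k) {g g′ : Fin k → C} → Injective _≡_ _≡_ g → Injective _≡_ _≡_ g′ →
                     (∀ u → Maybe.map g (owner ρ u) ≡ Maybe.map g′ (owner ρ′ u)) → ρ ≡ ρ′ × g ≗ g′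
  factorise-unique empty     empty       gi gi′ eq = refl , λ ()
  factorise-unique (skip ρ)  (skip ρ′)   gi gi′ eq
    with refl , g≗g′ ← factorise-unique ρ ρ′ gi gi′ (eq ∘ suc) = refl , g≗g′
  factorise-unique (skip ρ)  (new ρ′)    gi gi′ eq = contradiction (eq zero) λ ()
  factorise-unique (skip ρ)  (old _ ρ′)  gi gi′ eq = contradiction (eq zero) λ ()
  factorise-unique (new ρ)   (skip ρ′)   gi gi′ eq = contradiction (eq zero) λ ()
  factorise-unique (old _ ρ) (skip ρ′)   gi gi′ eq = contradiction (eq zero) λ ()
  factorise-unique (new ρ)   (new ρ′)    gi gi′ eq
    with refl , g≗g′ ← factorise-unique ρ ρ′ (Fin.suc-injective ∘ gi) (Fin.suc-injective ∘ gi′)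
      (λ u → trans (Maybe.map-∘ (owner ρ u)) (trans (eq (suc u)) (sym (Maybe.map-∘ (owner ρ′ u)))))
    = refl , λ { zero → Maybe.just-injective (eq zero) ; (suc i) → g≗g′ i }
  factorise-unique (new ρ)   (old j ρ′) gi gi′ eq = contradiction eq (new≢old ρ ρ′ j gi)
  factorise-unique (old j ρ) (new ρ′)   gi gi′ eq = contradiction (λ u → sym (eq u)) (new≢old ρ′ ρ j gi′)
  factorise-unique (old j ρ) (old j′ ρ′) gi gi′ eq
    with refl , g≗g′ ← factorise-unique ρ ρ′ gi gi′ (eq ∘ suc)
    with refl ← gi′ (trans (sym (g≗g′ j)) (Maybe.just-injective (eq zero))) = refl , g≗g′

  -- Enriched trees

  -- Agrees by definition with `children` when `k` is `n`, so that the membership lemmas apply to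
  -- sets of children too.
  fibre : (Fin n → Maybe (Fin k)) → Fin k → Subset n
  fibre o i = Vec.tabulate λ u → does (Maybe.≡-dec Fin._≟_ (o u) (just i))

  ∈-fibre⁺ : (o : Fin n → Maybe (Fin k)) {u : Fin n} {i : Fin k} → o u ≡ just i → u ∈ₛ fibre o i
  ∈-fibre⁺ o {u} e = Vec.lookup⇒[]= u _
    (trans (Vec.lookup∘tabulate _ u) (dec-true (Maybe.≡-dec Fin._≟_ _ _) e))

  ∈-fibre⁻ : (o : Fin n → Maybe (Fin k)) {u : Fin n} {i : Fin k} → u ∈ₛ fibre o i → o u ≡ just i
  ∈-fibre⁻ o {u} {i} u∈ with Maybe.≡-dec Fin._≟_ (o u) (just i)
    | trans (sym (Vec.lookup∘tabulate (λ u → does (Maybe.≡-dec Fin._≟_ (o u) (just i))) u)) (Vec.[]=⇒lookup u∈)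
  ... | yes e | _ = e

  ∈-⋃⁺ : {u : Fin n} {bs : List (Subset n)} → Any (u ∈ₛ_) bs → u ∈ₛ ⋃ bs
  ∈-⋃⁺ (here u∈B)  = Subset.x∈p∪q⁺ (inj₁ u∈B)
  ∈-⋃⁺ (there u∈) = Subset.x∈p∪q⁺ (inj₂ (∈-⋃⁺ u∈))

  ∈-⋃⁻ : {u : Fin n} (bs : List (Subset n)) → u ∈ₛ ⋃ bs → Any (u ∈ₛ_) bs
  ∈-⋃⁻ []       u∈ = contradiction u∈ Subset.∉⊥
  ∈-⋃⁻ (B ∷ bs) u∈ with Subset.x∈p∪q⁻ B (⋃ bs) u∈
  ... | inj₁ u∈B = here u∈B
  ... | inj₂ u∈′ = there (∈-⋃⁻ bs u∈′)

  disjoint⇒same : {u : Fin n} {B C : Subset n} {bs : List (Subset n)} → AllPairs Disjoint bs →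
                  B ∈ bs → C ∈ bs → u ∈ₛ B → u ∈ₛ C → B ≡ C
  disjoint⇒same (_ ∷ ds) (here refl) (here refl) _   _   = refl
  disjoint⇒same (d ∷ _)  (here refl) (there C∈)  u∈B u∈C =
    contradiction (_ , Subset.x∈p∩q⁺ (u∈B , u∈C)) (All.lookup d C∈)
  disjoint⇒same (d ∷ _)  (there B∈)  (here refl) u∈B u∈C =
    contradiction (_ , Subset.x∈p∩q⁺ (u∈C , u∈B)) (All.lookup d B∈)
  disjoint⇒same (_ ∷ ds) (there B∈)  (there C∈)  u∈B u∈C = disjoint⇒same ds B∈ C∈ u∈B u∈C

  lookup-ext : {f g : Vec A k} → Vec.lookup f ≗ Vec.lookup g → f ≡ g
  lookup-ext {f = f} {g} eq = trans (sym (Vec.tabulate∘lookup f)) (trans (Vec.tabulate-cong eq) (Vec.tabulate∘lookup g))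

  map-just⁻ : {B : Set} {f : A → B} (x : Maybe A) {b : B} → Maybe.map f x ≡ just b → ∃[ a ] x ≡ just a × f a ≡ b
  map-just⁻ (just a) refl = a , refl , refl

  root-unique : {p : Fin n → Maybe (Fin n)} ((v , _) : IsRootedTree p) → ∀ u → p u ≡ nothing → u ≡ v
  root-unique (v , _ , reach) u e with reach u
  ... | ε      = refl
  ... | e′ ◅ _ = contradiction (trans (sym e) e′) λ ()

  module _ (t : EnrichedTree n) where

    block-unique : ∀ {v u B C} → B ∈ blocks t v → C ∈ blocks t v → u ∈ₛ B → u ∈ₛ C → B ≡ C
    block-unique {v} = disjoint⇒same (IsPartition.disjoint (proj₂ (partition t v)))

    block⇒parent : ∀ {v u B} → B ∈ blocks t v → u ∈ₛ B → parent t u ≡ just v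
    block⇒parent {v} B∈ u∈B = ∈-fibre⁻ (parent t)
      (subst (_ ∈ₛ_) (IsPartition.covers (proj₂ (partition t v))) (∈-⋃⁺ (lose B∈ u∈B)))

    parent⇒block : ∀ {v u} → parent t u ≡ just v → ∃[ B ] B ∈ blocks t v × u ∈ₛ B
    parent⇒block {v} e = find (∈-⋃⁻ (blocks t v)
      (subst (_ ∈ₛ_) (sym (IsPartition.covers (proj₂ (partition t v)))) (∈-fibre⁺ (parent t) e)))

  -- The i-th entry of the vector is the common parent of the i-th block.
  Code : ℕ → ℕ → Set
  Code n k = Part 1 n k × Vec (Fin n) k

  -- The blocks of a tree are listed in an arbitrary order. The conditions mention only membership
  -- in these lists, and therefore respect `_≈ₜ_`.
  record Encodes (c : Code n k) (t : EnrichedTree n) : Set where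
    private
      o : Fin n → Maybe (Fin k)
      o = owner (proj₁ c)

      f : Fin k → Fin n
      f = Vec.lookup (proj₂ c)

    field
      parent-≡ : ∀ u → parent t u ≡ Maybe.map f (o u)
      fibre∈   : ∀ i → fibre o i ∈ blocks t (f i)
      isFibre  : ∀ {v B} → B ∈ blocks t v → ∃[ i ] f i ≡ v × B ≡ fibre o i

    labelled : Fin k → Fin n × Subset n
    labelled i = f i , fibre o i

    labelled-injective : Injective _≡_ _≡_ labelled
    labelled-injective {i} {j} eq =
      let u , e = owner-surjective (proj₁ c) i
          u∈j   = subst (u ∈ₛ_) (cong proj₂ eq) (∈-fibre⁺ o e)
      in Maybe.just-injective (trans (sym e) (∈-fibre⁻ o u∈j))

    parent⇒owner : ∀ {u v} → parent t u ≡ just v → ∃[ i ] o u ≡ just i × f i ≡ v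
    parent⇒owner {u} e = map-just⁻ (o u) (trans (sym (parent-≡ u)) e)

    star⇒grounded : ∀ {u v} → parent t v ≡ nothing → Star (λ u w → parent t u ≡ just w) u v →
                    Grounded o (proj₂ c) u
    star⇒grounded pv ε        = root (map-nothing (trans (sym (parent-≡ _)) pv))
    star⇒grounded pv (e ◅ es) with i , oi , refl ← parent⇒owner e = step oi (star⇒grounded pv es)

    acyclic : Acyclic o (proj₂ c)
    acyclic = let v , pv , reach = isRootedTree t in grounded⇒acyclic (star⇒grounded pv ∘ reach)

    -- The pairs of a vertex and one of its blocks have the same members as the labelled fibres, and
    -- neither list has repetitions, so each is a permutation of the other. The vertex in the pair
    -- keeps the lists of different vertices apart.
    numBlocks-≡ : numBlocks t ≡ k
    numBlocks-≡ = begin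
      sum (List.tabulate (length ∘ blocks t))  ≡⟨ length-pairs ⟨
      length pairs                             ≡⟨ ↭-length (∼bag⇒↭ (unique∧set⇒bag pairs-unique
                                                    (Unique.map⁺ labelled-injective (Unique.allFin⁺ k)) (mk⇔ to from))) ⟩
      length (map labelled (allFin k))         ≡⟨ List.length-map labelled (allFin k) ⟩
      length (allFin k)                        ≡⟨ length-allFin k ⟩
      k                                        ∎
      where
      open ≡-Reasoning

      pairsAt : Fin n → List (Fin n × Subset n)
      pairsAt v = map (v ,_) (blocks t v)

      pairs : List (Fin n × Subset n)
      pairs = concatMap pairsAt (allFin n)

      pairs-unique : Unique pairs
      pairs-unique = concatMap-unique proj₁
        (λ v → Unique.map⁺ (λ { refl → refl }) (partition-unique (proj₂ (partition t v))))
        (λ v p∈ → case Mem.∈-map⁻ (v ,_) p∈ of λ { (_ , _ , refl) → refl })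
        (Unique.allFin⁺ n)

      to : ∀ {p} → p ∈ pairs → p ∈ map labelled (allFin k)
      to p∈ with v , _ , p∈v ← find (Mem.∈-concatMap⁻ pairsAt {xs = allFin n} p∈)
            with B , B∈ , refl ← Mem.∈-map⁻ (v ,_) p∈v
            with i , refl , refl ← isFibre B∈ = Mem.∈-map⁺ labelled (Mem.∈-allFin i)

      from : ∀ {p} → p ∈ map labelled (allFin k) → p ∈ pairs
      from p∈ with i , _ , refl ← Mem.∈-map⁻ labelled p∈ =
        Mem.∈-concatMap⁺ pairsAt (lose (Mem.∈-allFin (f i)) (Mem.∈-map⁺ (f i ,_) (fibre∈ i)))

      length-concatMap : ∀ {m} (g : Fin m → Fin n) →
        length (concatMap pairsAt (List.tabulate g)) ≡ sum (List.tabulate (length ∘ blocks t ∘ g))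
      length-concatMap {zero}  g = refl
      length-concatMap {suc m} g = trans (List.length-++ (pairsAt (g zero)))
        (cong₂ _+_ (List.length-map _ (blocks t (g zero))) (length-concatMap (g ∘ suc)))

      length-pairs : length pairs ≡ sum (List.tabulate (length ∘ blocks t))
      length-pairs = length-concatMap (λ v → v)

  open Encodes

  encodes⇒≈ : {c : Code n k} {s t : EnrichedTree n} → Encodes c s → Encodes c t → s ≈ₜ t
  encodes⇒≈ {c = c} {s} {t} es et =
    (λ u → trans (parent-≡ es u) (sym (parent-≡ et u))) , λ v → sub es et , sub et es
    where
    sub : ∀ {s t v B} → Encodes c s → Encodes c t → B ∈ blocks s v → B ∈ blocks t v
    sub es et B∈ with i , refl , refl ← isFibre es B∈ = fibre∈ et i

  -- Both codes factor the same map, which sends a vertex other than the root to its parent and its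
  -- block; such a factorisation is unique.
  encodes-unique : {c d : Code n k} {t : EnrichedTree n} → Encodes c t → Encodes d t → c ≡ d
  encodes-unique {c = ρ , f} {ρ′ , f′} {t} ec ed =
    let ρ≡ρ′ , g≗g′ = factorise-unique ρ ρ′ (labelled-injective ec) (labelled-injective ed) agree
    in cong₂ _,_ ρ≡ρ′ (lookup-ext (cong proj₁ ∘ g≗g′))
    where
    agree : ∀ u → Maybe.map (labelled ec) (owner ρ u) ≡ Maybe.map (labelled ed) (owner ρ′ u)
    agree u with owner ρ u in e | owner ρ′ u in e′ | trans (sym (parent-≡ ec u)) (parent-≡ ed u)
    ... | nothing | nothing | _  = refl
    ... | just i  | just i′ | eq = cong just (cong₂ _,_ fi≡ (block-unique t (fibre∈ ec i)
          (subst (λ v → fibre (owner ρ′) i′ ∈ blocks t v) (sym fi≡) (fibre∈ ed i′))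
          (∈-fibre⁺ (owner ρ) e) (∈-fibre⁺ (owner ρ′) e′)))
      where fi≡ = Maybe.just-injective eq

  -- From codes to trees

  decode : (c : Code n k) → Acyclic (owner (proj₁ c)) (proj₂ c) → ∃ (Encodes c)
  decode {n} {k} c@(ρ , f) a = mkEnrichedTree p tree part , record
    { parent-≡ = λ _ → refl
    ; fibre∈   = λ i → Mem.∈-map⁺ (fibre o) (Mem.∈-filter⁺ (below? _) (Mem.∈-allFin i) refl)
    ; isFibre  = λ B∈ → let i , i∈ , eq = Mem.∈-map⁻ (fibre o) B∈ in
        i , proj₂ (Mem.∈-filter⁻ (below? _) {xs = allFin k} i∈) , eq
    }
    where
    o : Fin n → Maybe (Fin k)
    o = owner ρ

    p : Fin n → Maybe (Fin n)
    p = Maybe.map (Vec.lookup f) ∘ o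

    below? : ∀ v i → _
    below? v i = Vec.lookup f i Fin.≟ v

    bs : Fin n → List (Subset n)
    bs v = map (fibre o) (filter (below? v) (allFin k))

    climb : ∀ {u} → Grounded o f u → Star (λ u w → p u ≡ just w) u (proj₁ (owner-root ρ))
    climb (root e)   with refl ← owner-root-unique ρ e (proj₂ (owner-root ρ)) = ε
    climb (step e g) = cong (Maybe.map _) e ◅ climb g

    tree : IsRootedTree p
    tree = let v , e = owner-root ρ in v , cong (Maybe.map _) e , climb ∘ acyclic⇒grounded a

    covered : ∀ v → ⋃ (bs v) ≡ children p v
    covered v = Subset.⊆-antisym
      (λ u∈ → let B , B∈ , u∈B = find (∈-⋃⁻ (bs v) u∈)
                  i , i∈ , eq  = Mem.∈-map⁻ (fibre o) B∈
              in ∈-fibre⁺ p (trans (cong (Maybe.map _) (∈-fibre⁻ o (subst (_ ∈ₛ_) eq u∈B)))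
                   (cong just (proj₂ (Mem.∈-filter⁻ (below? v) {xs = allFin k} i∈)))))
      (λ {u} u∈ → let i , oi , fi = map-just⁻ (o u) (∈-fibre⁻ p u∈) in
        ∈-⋃⁺ (lose (Mem.∈-map⁺ (fibre o) (Mem.∈-filter⁺ (below? v) (Mem.∈-allFin i) fi)) (∈-fibre⁺ o oi)))

    apart : ∀ {i j} → i ≢ j → Disjoint (fibre o i) (fibre o j)
    apart i≢j (u , u∈) = let u∈i , u∈j = Subset.x∈p∩q⁻ _ _ u∈ in
      i≢j (Maybe.just-injective (trans (sym (∈-fibre⁻ o u∈i)) (∈-fibre⁻ o u∈j)))

    part : ∀ v → SetPartition (children p v)
    part v = bs v , mkIsPartition
      (All.map⁺ (All.tabulate λ {i} _ → let u , e = owner-surjective ρ i in u , ∈-fibre⁺ o e))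
      (AllPairs.map⁺ (AllPairs.map apart (Unique.filter⁺ (below? v) (Unique.allFin⁺ k))))
      (covered v)

  -- From trees to codes

  module _ (t : EnrichedTree n) where

    -- The label of a vertex consists of its parent and the block that contains it. Keeping the
    -- parent in the label lets the vector of the code be read off the numbering `g` as `proj₁ ∘ g`.
    Class : Fin n → Maybe (Fin n × Subset n) → Set
    Class u nothing        = parent t u ≡ nothing
    Class u (just (v , B)) = parent t u ≡ just v × B ∈ blocks t v × u ∈ₛ B

    classify : ∀ u → ∃ (Class u)
    classify u with parent t u in e
    ... | nothing = nothing , e
    ... | just v  = let B , B∈ , u∈B = parent⇒block t e in just (v , B) , e , B∈ , u∈B

    class : Fin n → Maybe (Fin n × Subset n)
    class = proj₁ ∘ classify

    parent-class : ∀ u → parent t u ≡ Maybe.map proj₁ (class u)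
    parent-class u with classify u
    ... | nothing , e     = e
    ... | just _  , e , _ = e

    class⇒block : ∀ {u x} → class u ≡ just x → proj₂ x ∈ blocks t (proj₁ x) × u ∈ₛ proj₂ x
    class⇒block {u} eq with just _ , _ , B∈ , u∈B ← classify u | refl ← eq = B∈ , u∈B

    block⇒class : ∀ {u v B} → B ∈ blocks t v → u ∈ₛ B → class u ≡ just (v , B)
    block⇒class {u} B∈ u∈B with classify u | block⇒parent t B∈ u∈B
    ... | nothing , e′            | e = contradiction (trans (sym e′) e) λ ()
    ... | just _ , e′ , C∈ , u∈C | e with refl ← Maybe.just-injective (trans (sym e′) e) =
      cong (just ∘ (_ ,_)) (block-unique t C∈ B∈ u∈C u∈B)

    factorisation-encodes : (ρ : Part 1 n k) (g : Fin k → Fin n × Subset n) → Injective _≡_ _≡_ g →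
                            (∀ u → class u ≡ Maybe.map g (owner ρ u)) →
                            Encodes (ρ , Vec.tabulate (proj₁ ∘ g)) t
    factorisation-encodes {k} ρ g g-inj eq = record
      { parent-≡ = λ u → begin
          parent t u                                    ≡⟨ parent-class u ⟩
          Maybe.map proj₁ (class u)                     ≡⟨ cong (Maybe.map proj₁) (eq u) ⟩
          Maybe.map proj₁ (Maybe.map g (o u))           ≡⟨ Maybe.map-∘ (o u) ⟨
          Maybe.map (proj₁ ∘ g) (o u)                   ≡⟨ Maybe.map-cong f-≡ (o u) ⟨
          Maybe.map f (o u)                             ∎
      ; fibre∈ = λ i → let u , e = owner-surjective ρ i in
          subst₂ (λ B v → B ∈ blocks t v) (fibre-≡ i) (sym (f-≡ i)) (proj₁ (class⇒block (owner⇒class e)))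
      -- A block is nonempty, so the class of one of its vertices gives it a number.
      ; isFibre = λ {v} B∈ →
          let u , u∈B  = All.lookup (IsPartition.nonempty (proj₂ (partition t v))) B∈
              i , _ , gi = class⇒owner (block⇒class B∈ u∈B)
          in i , trans (f-≡ i) (cong proj₁ gi) , trans (sym (cong proj₂ gi)) (fibre-≡ i)
      }
      where
      open ≡-Reasoning

      o : Fin n → Maybe (Fin k)
      o = owner ρ

      f : Fin k → Fin n
      f = Vec.lookup (Vec.tabulate (proj₁ ∘ g))

      f-≡ : f ≗ proj₁ ∘ g
      f-≡ = Vec.lookup∘tabulate (proj₁ ∘ g)

      owner⇒class : ∀ {u i} → o u ≡ just i → class u ≡ just (g i)
      owner⇒class {u} e = trans (eq u) (cong (Maybe.map g) e)

      class⇒owner : ∀ {u x} → class u ≡ just x → ∃[ i ] o u ≡ just i × g i ≡ x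
      class⇒owner {u} e = map-just⁻ (o u) (trans (sym (eq u)) e)

      fibre-≡ : ∀ i → proj₂ (g i) ≡ fibre o i
      fibre-≡ i = Subset.⊆-antisym
        (λ u∈B → let u₀ , e = owner-surjective ρ i
                     j , oj , gj = class⇒owner (block⇒class (proj₁ (class⇒block (owner⇒class e))) u∈B)
                 in ∈-fibre⁺ o (trans oj (cong just (g-inj gj))))
        (λ u∈ → proj₂ (class⇒block (owner⇒class (∈-fibre⁻ o u∈))))

    encode : ∃[ k ] ∃ λ (c : Code n k) → Encodes c t
    encode with r , k , ρ , g , g-inj , eq ← factorise (Product.≡-dec Fin._≟_ _≟ₛ_) class
           with refl ← roots≡1 ρ {proj₁ (isRootedTree t)}
             (map-nothing (trans (sym (eq _)) (map-nothing (trans (sym (parent-class _)) (proj₁ (proj₂ (isRootedTree t)))))))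
             (λ u e → root-unique (isRootedTree t) u
               (trans (parent-class u) (cong (Maybe.map proj₁) (trans (eq u) (cong (Maybe.map g) e)))))
      = k , _ , factorisation-encodes ρ g g-inj eq

  -- The number of codes and of trees

  codes : ∀ n k → List (Code n k)
  codes n k = concatMap (λ ρ → map (ρ ,_) (acyclics (allFin n) (owner ρ))) (parts 1 n k)

  ∈-codes⁺ : {c : Code n k} → Acyclic (owner (proj₁ c)) (proj₂ c) → c ∈ codes n k
  ∈-codes⁺ {n} {c = ρ , f} a = Mem.∈-concatMap⁺ (λ ρ → map (ρ ,_) (acyclics (allFin n) (owner ρ)))
    (lose (∈-parts ρ) (Mem.∈-map⁺ (ρ ,_) (∈-acyclics⁺ (allFin n) Mem.∈-allFin a)))

  ∈-codes⁻ : {c : Code n k} → c ∈ codes n k → Acyclic (owner (proj₁ c)) (proj₂ c)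
  ∈-codes⁻ {n} {k} c∈
    with ρ , _ , c∈ρ ← find (Mem.∈-concatMap⁻ (λ ρ → map (ρ ,_) (acyclics (allFin n) (owner ρ))) {xs = parts 1 n k} c∈)
    with f , f∈ , refl ← Mem.∈-map⁻ (ρ ,_) c∈ρ = ∈-acyclics⁻ (allFin n) (owner ρ) f∈

  codes-unique : ∀ n k → Unique (codes n k)
  codes-unique n k = concatMap-unique proj₁
    (λ ρ → Unique.map⁺ (λ { refl → refl }) (acyclics-unique (allFin n) (Unique.allFin⁺ n) (owner ρ)))
    (λ ρ c∈ → case Mem.∈-map⁻ (ρ ,_) c∈ of λ { (_ , _ , refl) → refl })
    (parts-unique 1 n k)

  -- The choice of the root contributes a factor `N` through `length-parts₁`; it cancels against the
  -- `N` by which `length-acyclics` multiplies the number of maps.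
  length-codes : ∀ m k → length (codes (suc m) k) ≡ suc m ^ k * stirling m k
  length-codes m k = ℕ.*-cancelʳ-≡ _ _ (suc m) (begin
    length (codes N k) * N            ≡⟨ length-concatMap-* len (parts 1 N k) ⟩
    length (parts 1 N k) * N ^ k      ≡⟨ cong (_* N ^ k) (length-parts₁ m k) ⟩
    N * stirling m k * N ^ k          ≡⟨ regroup N (stirling m k) (N ^ k) ⟩
    N ^ k * stirling m k * N          ∎)
    where
    open ≡-Reasoning

    N : ℕ
    N = suc m

    regroup : ∀ a b c → a * b * c ≡ c * b * a
    regroup = solve-∀

    len : ∀ ρ → length (map (ρ ,_) (acyclics (allFin N) (owner ρ))) * N ≡ N ^ k
    len ρ = begin
      length (map (ρ ,_) fs) * N                                  ≡⟨ cong (_* N) (List.length-map (ρ ,_) fs) ⟩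
      length fs * N                                               ≡⟨ cong (length fs *_) (length-allFin N) ⟨
      length fs * length (allFin N)                               ≡⟨ length-acyclics (allFin N) (owner ρ) ⟩
      rootCount (owner ρ) (allFin N) * length (allFin N) ^ k      ≡⟨ cong₂ (λ r l → r * l ^ k) (rootCount-owner ρ) (length-allFin N) ⟩
      1 * N ^ k                                                   ≡⟨ ℕ.*-identityˡ _ ⟩
      N ^ k                                                       ∎
      where
      fs : List (Vec (Fin N) k)
      fs = acyclics (allFin N) (owner ρ)

  encodes-resp : {c : Code n k} {s t : EnrichedTree n} → s ≈ₜ t → Encodes c s → Encodes c t
  encodes-resp (p , b) e = record
    { parent-≡ = λ u → trans (sym (p u)) (parent-≡ e u)
    ; fibre∈   = λ i → proj₁ (b _) (fibre∈ e i)
    ; isFibre  = λ B∈ → isFibre e (proj₂ (b _) B∈)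
    }

  treesWith : ∀ n k → List (EnrichedTree n)
  treesWith n k = filter (λ t → numBlocks t ℕ.≟ k) (enrichedTrees n)

  -- Two inequalities: a code determines its tree up to `_≈ₜ_`, and the enumeration has no two
  -- equivalent trees; conversely, a tree determines its code.
  length-treesWith : ∀ m k → length (treesWith (suc m) k) ≡ suc m ^ k * stirling m k
  length-treesWith m k = trans (ℕ.≤-antisym
    (length-≤ (flip Encodes)
      (AllPairs.map (λ ¬s≈t c es et → ¬s≈t (encodes⇒≈ es et))
        (AllPairs.filter⁺ (λ t → numBlocks t ℕ.≟ k) (enrichedTrees-unique N)))
      λ t∈ → coded (proj₂ (Mem.∈-filter⁻ (λ t → numBlocks t ℕ.≟ k) {xs = enrichedTrees N} t∈)))
    (length-≤ Encodes
      (AllPairs.map (λ c≢d t ec ed → c≢d (encodes-unique ec ed)) (codes-unique N k))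
      λ c∈ → decoded (∈-codes⁻ c∈)))
    (length-codes m k)
    where
    N : ℕ
    N = suc m

    coded : {t : EnrichedTree N} → numBlocks t ≡ k → Any (λ c → Encodes c t) (codes N k)
    coded {t} nb with k′ , c , e ← encode t with refl ← trans (sym (numBlocks-≡ e)) nb =
      lose (∈-codes⁺ (acyclic e)) e

    decoded : {c : Code N k} → Acyclic (owner (proj₁ c)) (proj₂ c) → Any (Encodes c) (treesWith N k)
    decoded {c} a =
      -- The decoded tree need not itself be listed; its representative `s` is, and inherits the
      -- code and with it the number of blocks.
      let t , e = decode c a
          s , s∈ , t≈s = find (enrichedTrees-complete N t)
          e′ = encodes-resp t≈s e
      in lose (Mem.∈-filter⁺ (λ t → numBlocks t ℕ.≟ k) s∈ (numBlocks-≡ e′)) e′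

open Counting using (stirling; length-treesWith)
open import Data.Rational.Base using (_+_; _*_)
open +-*-Solver using (solve; _:+_; _:*_; _:=_; con)

-- Arithmetic of fromℕ

fromℚᵘ-+ : ∀ p q → fromℚᵘ (p ℚᵘ.+ q) ≡ fromℚᵘ p + fromℚᵘ q
fromℚᵘ-+ p q = ℚ.toℚᵘ-injective (begin
  toℚᵘ (fromℚᵘ (p ℚᵘ.+ q))               ≈⟨ ℚ.toℚᵘ-fromℚᵘ (p ℚᵘ.+ q) ⟩
  p ℚᵘ.+ q                               ≈⟨ ℚᵘ.+-cong (ℚ.toℚᵘ-fromℚᵘ p) (ℚ.toℚᵘ-fromℚᵘ q) ⟨
  toℚᵘ (fromℚᵘ p) ℚᵘ.+ toℚᵘ (fromℚᵘ q)   ≈⟨ ℚ.toℚᵘ-homo-+ (fromℚᵘ p) (fromℚᵘ q) ⟨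
  toℚᵘ (fromℚᵘ p + fromℚᵘ q)             ∎)
  where open ℚᵘ.≃-Reasoning

fromℚᵘ-* : ∀ p q → fromℚᵘ (p ℚᵘ.* q) ≡ fromℚᵘ p * fromℚᵘ q
fromℚᵘ-* p q = ℚ.toℚᵘ-injective (begin
  toℚᵘ (fromℚᵘ (p ℚᵘ.* q))               ≈⟨ ℚ.toℚᵘ-fromℚᵘ (p ℚᵘ.* q) ⟩
  p ℚᵘ.* q                               ≈⟨ ℚᵘ.*-cong (ℚ.toℚᵘ-fromℚᵘ p) (ℚ.toℚᵘ-fromℚᵘ q) ⟨
  toℚᵘ (fromℚᵘ p) ℚᵘ.* toℚᵘ (fromℚᵘ q)   ≈⟨ ℚ.toℚᵘ-homo-* (fromℚᵘ p) (fromℚᵘ q) ⟨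
  toℚᵘ (fromℚᵘ p * fromℚᵘ q)             ∎)
  where open ℚᵘ.≃-Reasoning

-- fromℕ n unfolds to fromℚᵘ (mkℚᵘ (ℤ.+ n) 0).
fromℕ-+ : ∀ m n → fromℕ (m ℕ.+ n) ≡ fromℕ m + fromℕ n
fromℕ-+ m n = trans
  (ℚ.fromℚᵘ-cong {mkℚᵘ (ℤ.+ (m ℕ.+ n)) 0} {mkℚᵘ (ℤ.+ m) 0 ℚᵘ.+ mkℚᵘ (ℤ.+ n) 0}
    (*≡* (cong (ℤ._* ℤ.+ 1) (sym (cong₂ ℤ._+_ (ℤ.*-identityʳ (ℤ.+ m)) (ℤ.*-identityʳ (ℤ.+ n)))))))
  (fromℚᵘ-+ (mkℚᵘ (ℤ.+ m) 0) (mkℚᵘ (ℤ.+ n) 0))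

fromℕ-* : ∀ m n → fromℕ (m ℕ.* n) ≡ fromℕ m * fromℕ n
fromℕ-* m n = trans
  (ℚ.fromℚᵘ-cong {mkℚᵘ (ℤ.+ (m ℕ.* n)) 0} {mkℚᵘ (ℤ.+ m) 0 ℚᵘ.* mkℚᵘ (ℤ.+ n) 0}
    (*≡* (cong (ℤ._* ℤ.+ 1) (ℤ.pos-* m n))))
  (fromℚᵘ-* (mkℚᵘ (ℤ.+ m) 0) (mkℚᵘ (ℤ.+ n) 0))

fromℕ-suc : ∀ n → fromℕ (suc n) ≡ 1ℚ + fromℕ n
fromℕ-suc = fromℕ-+ 1

fromℕ-inverse : ∀ n .{{_ : NonZero n}} → fromℕ n * (ℤ.+ 1 / n) ≡ 1ℚ
fromℕ-inverse n@(suc d) = trans (sym (fromℚᵘ-* (mkℚᵘ (ℤ.+ n) 0) (mkℚᵘ (ℤ.+ 1) d)))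
  (ℚ.fromℚᵘ-cong {mkℚᵘ (ℤ.+ n) 0 ℚᵘ.* mkℚᵘ (ℤ.+ 1) d} {mkℚᵘ (ℤ.+ 1) 0} (*≡* (cong (ℤ.+_ ∘ suc) (units d))))
  where
  units : ∀ d → d ℕ.* 1 ℕ.* 1 ≡ d ℕ.+ 0 ℕ.+ 0
  units = solve-∀

factorialInverse : ℕ → ℚ
factorialInverse m = _/_ (ℤ.+ 1) (m !) {{m ℕ.!≢0}}

factorialInverse-! : ∀ m → fromℕ (m !) * factorialInverse m ≡ 1ℚ
factorialInverse-! m = fromℕ-inverse (m !) {{m ℕ.!≢0}}

factorialInverse-suc : ∀ m → fromℕ (suc m) * factorialInverse (suc m) ≡ factorialInverse m
factorialInverse-suc m = begin
  s * i′             ≡⟨ ℚ.*-identityʳ (s * i′) ⟨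
  s * i′ * 1ℚ        ≡⟨ cong (s * i′ *_) (factorialInverse-! m) ⟨
  s * i′ * (f * i)   ≡⟨ solve 4 (λ s i′ f i → s :* i′ :* (f :* i) := s :* f :* i′ :* i) refl s i′ f i ⟩
  s * f * i′ * i     ≡⟨ cong (λ x → x * i′ * i) (fromℕ-* (suc m) (m !)) ⟨
  fromℕ (suc m !) * i′ * i ≡⟨ cong (_* i) (factorialInverse-! (suc m)) ⟩
  1ℚ * i             ≡⟨ ℚ.*-identityˡ i ⟩
  i                  ∎
  where
  open ≡-Reasoning
  s i i′ f : ℚ
  s  = fromℕ (suc m)
  i  = factorialInverse m
  i′ = factorialInverse (suc m)
  f  = fromℕ (m !)

-- Sequences of rationals

∑ : ℕ → (ℕ → ℚ) → ℚ
∑ zero    f = 0ℚ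
∑ (suc n) f = f 0 + ∑ n (f ∘ suc)

∑-cong : ∀ n {f g : ℕ → ℚ} → f ≗ g → ∑ n f ≡ ∑ n g
∑-cong zero    f≗g = refl
∑-cong (suc n) f≗g = cong₂ _+_ (f≗g 0) (∑-cong n (f≗g ∘ suc))

∑-zero : ∀ n {f : ℕ → ℚ} → (∀ i → i < n → f i ≡ 0ℚ) → ∑ n f ≡ 0ℚ
∑-zero zero    f≡0 = refl
∑-zero (suc n) f≡0 = cong₂ _+_ (f≡0 0 ℕ.z<s) (∑-zero n λ i i<n → f≡0 (suc i) (s≤s i<n))

∑-single : ∀ n k {f : ℕ → ℚ} → k < n → (∀ i → i ≢ k → f i ≡ 0ℚ) → ∑ n f ≡ f k
∑-single (suc n) zero    {f} _         f≡0 = trans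
  (cong (f 0 +_) (∑-zero n λ i _ → f≡0 (suc i) λ ())) (ℚ.+-identityʳ (f 0))
∑-single (suc n) (suc k) {f} (s≤s k<n) f≡0 = trans
  (cong₂ _+_ (f≡0 0 λ ()) (∑-single n k k<n λ i i≢k → f≡0 (suc i) (i≢k ∘ ℕ.suc-injective)))
  (ℚ.+-identityˡ (f (suc k)))

∑-+ : ∀ n (f g : ℕ → ℚ) → ∑ n (λ i → f i + g i) ≡ ∑ n f + ∑ n g
∑-+ zero    f g = refl
∑-+ (suc n) f g = trans (cong (f 0 + g 0 +_) (∑-+ n (f ∘ suc) (g ∘ suc)))
  (solve 4 (λ a b c d → (a :+ b) :+ (c :+ d) := (a :+ c) :+ (b :+ d)) refl
    (f 0) (g 0) (∑ n (f ∘ suc)) (∑ n (g ∘ suc)))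

∑-* : ∀ n c (f : ℕ → ℚ) → ∑ n (λ i → c * f i) ≡ c * ∑ n f
∑-* zero    c f = sym (ℚ.*-zeroʳ c)
∑-* (suc n) c f = trans (cong (c * f 0 +_) (∑-* n c (f ∘ suc))) (sym (ℚ.*-distribˡ-+ c (f 0) (∑ n (f ∘ suc))))

-- The Cauchy product, which serves both for polynomials in x and for power series in t.
infixl 7 _⋆_
_⋆_ : (ℕ → ℚ) → (ℕ → ℚ) → ℕ → ℚ
(a ⋆ b) m = ∑ (suc m) (λ i → a i * b (m ∸ i))

⋆-cong : ∀ {a a′ b b′ : ℕ → ℚ} → a ≗ a′ → b ≗ b′ → a ⋆ b ≗ a′ ⋆ b′
⋆-cong a≗ b≗ m = ∑-cong (suc m) λ i → cong₂ _*_ (a≗ i) (b≗ (m ∸ i))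

⋆-distribʳ-+ : ∀ (a a′ b : ℕ → ℚ) m → ((λ i → a i + a′ i) ⋆ b) m ≡ (a ⋆ b) m + (a′ ⋆ b) m
⋆-distribʳ-+ a a′ b m = trans
  (∑-cong (suc m) λ i → ℚ.*-distribʳ-+ (b (m ∸ i)) (a i) (a′ i))
  (∑-+ (suc m) (λ i → a i * b (m ∸ i)) (λ i → a′ i * b (m ∸ i)))

⋆-distribˡ-+ : ∀ (a b b′ : ℕ → ℚ) m → (a ⋆ (λ i → b i + b′ i)) m ≡ (a ⋆ b) m + (a ⋆ b′) m
⋆-distribˡ-+ a b b′ m = trans
  (∑-cong (suc m) λ i → ℚ.*-distribˡ-+ (a i) (b (m ∸ i)) (b′ (m ∸ i)))
  (∑-+ (suc m) (λ i → a i * b (m ∸ i)) (λ i → a i * b′ (m ∸ i)))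

⋆-scaleʳ : ∀ c (a b : ℕ → ℚ) m → (a ⋆ (λ i → c * b i)) m ≡ c * (a ⋆ b) m
⋆-scaleʳ c a b m = trans
  (∑-cong (suc m) λ i → solve 3 (λ x c y → x :* (c :* y) := c :* (x :* y)) refl (a i) c (b (m ∸ i)))
  (∑-* (suc m) c (λ i → a i * b (m ∸ i)))

-- The coefficient sequence of the monomial a xᵏ.
single : ℕ → ℚ → ℕ → ℚ
single zero    a zero    = a
single zero    a (suc j) = 0ℚ
single (suc k) a zero    = 0ℚ
single (suc k) a (suc j) = single k a j

single-refl : ∀ k a → single k a k ≡ a
single-refl zero    a = refl
single-refl (suc k) a = single-refl k a

single-≢ : ∀ k a j → k ≢ j → single k a j ≡ 0ℚ
single-≢ zero    a zero    k≢j = contradiction refl k≢j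
single-≢ zero    a (suc j) k≢j = refl
single-≢ (suc k) a zero    k≢j = refl
single-≢ (suc k) a (suc j) k≢j = single-≢ k a j (k≢j ∘ cong suc)

single-* : ∀ k a b j → a * single k b j ≡ single k (a * b) j
single-* zero    a b zero    = refl
single-* zero    a b (suc j) = ℚ.*-zeroʳ a
single-* (suc k) a b zero    = ℚ.*-zeroʳ a
single-* (suc k) a b (suc j) = single-* k a b j

single-+ : ∀ k a b j → single k a j + single k b j ≡ single k (a + b) j
single-+ zero    a b zero    = refl
single-+ zero    a b (suc j) = refl
single-+ (suc k) a b zero    = refl
single-+ (suc k) a b (suc j) = single-+ k a b j

single-0 : ∀ k j → single k 0ℚ j ≡ 0ℚ
single-0 zero    zero    = refl
single-0 zero    (suc j) = refl
single-0 (suc k) zero    = refl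
single-0 (suc k) (suc j) = single-0 k j

single₀-⋆ : ∀ a b → single 0 a ⋆ b ≗ (λ m → a * b m)
single₀-⋆ a b m = trans
  (cong (a * b m +_) (∑-zero m {λ i → 0ℚ * b (m ∸ suc i)} λ i _ → ℚ.*-zeroˡ (b (m ∸ suc i))))
  (ℚ.+-identityʳ (a * b m))

single₊-⋆-suc : ∀ k a b m → (single (suc k) a ⋆ b) (suc m) ≡ (single k a ⋆ b) m
single₊-⋆-suc k a b m = trans
  (cong (_+ (single k a ⋆ b) m) (ℚ.*-zeroˡ (b (suc m)))) (ℚ.+-identityˡ ((single k a ⋆ b) m))

single-⋆-single : ∀ i j a b → single i a ⋆ single j b ≗ single (i ℕ.+ j) (a * b)
single-⋆-single zero    j a b m       = trans (single₀-⋆ a (single j b) m) (single-* j a b m)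
single-⋆-single (suc i) j a b zero    = trans (ℚ.+-identityʳ (0ℚ * single j b 0)) (ℚ.*-zeroˡ (single j b 0))
single-⋆-single (suc i) j a b (suc m) = trans (single₊-⋆-suc i a (single j b) m) (single-⋆-single i j a b m)

-- Formal derivatives

derivative : (ℕ → ℚ) → ℕ → ℚ
derivative a m = fromℕ (suc m) * a (suc m)

-- With c the series of `a ∘ suc`, the series of `a` is a₀ + t c, and its derivative is c + t c′.
derivative-tail : ∀ a m → derivative a (suc m) ≡ a (suc (suc m)) + derivative (a ∘ suc) m
derivative-tail a m = begin
  fromℕ (suc (suc m)) * x        ≡⟨ cong (_* x) (fromℕ-suc (suc m)) ⟩
  (1ℚ + fromℕ (suc m)) * x       ≡⟨ ℚ.*-distribʳ-+ x 1ℚ (fromℕ (suc m)) ⟩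
  1ℚ * x + fromℕ (suc m) * x     ≡⟨ cong (_+ fromℕ (suc m) * x) (ℚ.*-identityˡ x) ⟩
  x + derivative (a ∘ suc) m     ∎
  where
  open ≡-Reasoning
  x : ℚ
  x = a (suc (suc m))

-- The Leibniz rule. Splitting off the constant term of `a` leaves t times the product of `a ∘ suc`
-- and `b`, for which the rule is needed in one degree less.
derivative-⋆ : ∀ a b m → derivative (a ⋆ b) m ≡ (derivative a ⋆ b) m + (a ⋆ derivative b) m
derivative-⋆ a b zero = solve 4
  (λ x y z w → con 1ℚ :* (x :* y :+ (z :* w :+ con 0ℚ)) :=
               con 1ℚ :* z :* w :+ con 0ℚ :+ (x :* (con 1ℚ :* y) :+ con 0ℚ)) refl (a 0) (b 1) (a 1) (b 0)
derivative-⋆ a b (suc m) = begin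
  s * (a 0 * b₂ + (a′ ⋆ b) (suc m))
    ≡⟨ ℚ.*-distribˡ-+ s (a 0 * b₂) ((a′ ⋆ b) (suc m)) ⟩
  s * (a 0 * b₂) + s * (a′ ⋆ b) (suc m)
    -- The sequence defined by cases is t times `a′ ⋆ b`, with constant term zero; its derivative in
    -- degree `suc m` is the second summand.
    ≡⟨ cong (s * (a 0 * b₂) +_) (derivative-tail (λ { zero → 0ℚ ; (suc i) → (a′ ⋆ b) i }) m) ⟩
  s * (a 0 * b₂) + ((a 1 * b₁ + (a′ ∘ suc ⋆ b) m) + derivative (a′ ⋆ b) m)
    ≡⟨ cong (λ x → s * (a 0 * b₂) + ((a 1 * b₁ + (a′ ∘ suc ⋆ b) m) + x)) (derivative-⋆ a′ b m) ⟩
  s * (a 0 * b₂) + ((a 1 * b₁ + (a′ ∘ suc ⋆ b) m) + ((derivative a′ ⋆ b) m + (a′ ⋆ derivative b) m))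
    ≡⟨ solve 7 (λ s x y z u v w → s :* (x :* y) :+ ((z :+ u) :+ (v :+ w)) :=
                                  (z :+ (u :+ v)) :+ (x :* (s :* y) :+ w)) refl
         s (a 0) b₂ (a 1 * b₁) ((a′ ∘ suc ⋆ b) m) ((derivative a′ ⋆ b) m) ((a′ ⋆ derivative b) m) ⟩
  (a 1 * b₁ + ((a′ ∘ suc ⋆ b) m + (derivative a′ ⋆ b) m)) + (a ⋆ derivative b) (suc m)
    ≡⟨ cong (λ x → (a 1 * b₁ + x) + (a ⋆ derivative b) (suc m)) (⋆-distribʳ-+ (a′ ∘ suc) (derivative a′) b m) ⟨
  (a 1 * b₁ + ((λ i → a (suc (suc i)) + derivative a′ i) ⋆ b) m) + (a ⋆ derivative b) (suc m)
    ≡⟨ cong₂ (λ x y → (x * b₁ + y) + (a ⋆ derivative b) (suc m)) (ℚ.*-identityˡ (a 1))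
         (⋆-cong {b = b} (derivative-tail a) (λ _ → refl) m) ⟨
  (derivative a ⋆ b) (suc m) + (a ⋆ derivative b) (suc m) ∎
  where
  open ≡-Reasoning
  a′ : ℕ → ℚ
  a′ = a ∘ suc
  s b₁ b₂ : ℚ
  s  = fromℕ (suc (suc m))
  b₁ = b (suc m)
  b₂ = b (suc (suc m))

fromℕ-cancelˡ : ∀ n {p q} → fromℕ (suc n) * p ≡ fromℕ (suc n) * q → p ≡ q
fromℕ-cancelˡ n {p} {q} eq = trans (sym (undo p)) (trans (cong (i *_) eq) (undo q))
  where
  i : ℚ
  i = ℤ.+ 1 / suc n

  undo : ∀ p → i * (fromℕ (suc n) * p) ≡ p
  undo p = begin
    i * (fromℕ (suc n) * p)  ≡⟨ solve 3 (λ i s p → i :* (s :* p) := s :* i :* p) refl i (fromℕ (suc n)) p ⟩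
    fromℕ (suc n) * i * p    ≡⟨ cong (_* p) (fromℕ-inverse (suc n)) ⟩
    1ℚ * p                   ≡⟨ ℚ.*-identityˡ p ⟩
    p                        ∎
    where open ≡-Reasoning

-- Powers of eᵗ − 1

expMinus1 : ℕ → ℚ
expMinus1 zero    = 0ℚ
expMinus1 (suc m) = factorialInverse (suc m)

expMinus1-derivative : ∀ m → derivative expMinus1 m ≡ expMinus1 m + single 0 1ℚ m
expMinus1-derivative zero    = refl
expMinus1-derivative (suc m) = trans (factorialInverse-suc (suc m)) (sym (ℚ.+-identityʳ (factorialInverse (suc m))))

power : ℕ → ℕ → ℚ
power zero    = single 0 1ℚ
power (suc j) = expMinus1 ⋆ power j

power-zero : ∀ j → power (suc j) 0 ≡ 0ℚ
power-zero j = trans (ℚ.+-identityʳ (0ℚ * power j 0)) (ℚ.*-zeroˡ (power j 0))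

-- ((eᵗ - 1)ʲ⁺¹)′ = (j + 1) ((eᵗ - 1)ʲ⁺¹ + (eᵗ - 1)ʲ)
power-derivative : ∀ j m → derivative (power (suc j)) m ≡ fromℕ (suc j) * (power (suc j) m + power j m)
power-derivative j m = begin
  derivative (expMinus1 ⋆ power j) m
    ≡⟨ derivative-⋆ expMinus1 (power j) m ⟩
  (derivative expMinus1 ⋆ power j) m + rest
    ≡⟨ cong (_+ rest) (⋆-cong {b = power j} expMinus1-derivative (λ _ → refl) m) ⟩
  ((λ i → expMinus1 i + single 0 1ℚ i) ⋆ power j) m + rest
    ≡⟨ cong (_+ rest) (⋆-distribʳ-+ expMinus1 (single 0 1ℚ) (power j) m) ⟩
  (power (suc j) m + (single 0 1ℚ ⋆ power j) m) + rest
    ≡⟨ cong (λ x → (power (suc j) m + x) + rest) (trans (single₀-⋆ 1ℚ (power j) m) (ℚ.*-identityˡ (power j m))) ⟩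
  (power (suc j) m + power j m) + rest
    ≡⟨ cong ((power (suc j) m + power j m) +_) (tail j) ⟩
  (power (suc j) m + power j m) + fromℕ j * (power (suc j) m + power j m)
    ≡⟨ solve 2 (λ x y → x :+ y :* x := (con 1ℚ :+ y) :* x) refl (power (suc j) m + power j m) (fromℕ j) ⟩
  (1ℚ + fromℕ j) * (power (suc j) m + power j m)
    ≡⟨ cong (_* (power (suc j) m + power j m)) (fromℕ-suc j) ⟨
  fromℕ (suc j) * (power (suc j) m + power j m) ∎
  where
  open ≡-Reasoning

  rest : ℚ
  rest = (expMinus1 ⋆ derivative (power j)) m

  -- Multiplying the derivative of the j-th power by eᵗ - 1 raises both of its powers by one; for
  -- `j = 0` the derivative of the constant 1 vanishes.
  tail : ∀ j → (expMinus1 ⋆ derivative (power j)) m ≡ fromℕ j * (power (suc j) m + power j m)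
  tail zero = trans
    (∑-zero (suc m) λ i _ → trans (cong (expMinus1 i *_) (ℚ.*-zeroʳ (fromℕ (suc (m ∸ i))))) (ℚ.*-zeroʳ (expMinus1 i)))
    (sym (ℚ.*-zeroˡ (power 1 m + power 0 m)))
  tail (suc j) = begin
    (expMinus1 ⋆ derivative (power (suc j))) m
      ≡⟨ ⋆-cong {expMinus1} (λ _ → refl) (power-derivative j) m ⟩
    (expMinus1 ⋆ (λ i → fromℕ (suc j) * (power (suc j) i + power j i))) m
      ≡⟨ ⋆-scaleʳ (fromℕ (suc j)) expMinus1 (λ i → power (suc j) i + power j i) m ⟩
    fromℕ (suc j) * (expMinus1 ⋆ (λ i → power (suc j) i + power j i)) m
      ≡⟨ cong (fromℕ (suc j) *_) (⋆-distribˡ-+ expMinus1 (power (suc j)) (power j) m) ⟩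
    fromℕ (suc j) * (power (suc (suc j)) m + power (suc j) m) ∎

power-stirling : ∀ j m → power j m ≡ fromℕ (j ! ℕ.* stirling m j) * factorialInverse m
power-stirling zero    zero    = refl
power-stirling zero    (suc m) = sym (ℚ.*-zeroˡ (factorialInverse (suc m)))
power-stirling (suc j) zero    = trans (power-zero j)
  (sym (cong (λ x → fromℕ x * factorialInverse 0) (ℕ.*-zeroʳ (suc j !))))
power-stirling (suc j) (suc m) = fromℕ-cancelˡ m (begin
  fromℕ (suc m) * power (suc j) (suc m)
    ≡⟨ power-derivative j m ⟩
  fromℕ (suc j) * (power (suc j) m + power j m)
    ≡⟨ cong (fromℕ (suc j) *_) (cong₂ _+_ (power-stirling (suc j) m) (power-stirling j m)) ⟩
  fromℕ (suc j) * (fromℕ u * i + fromℕ v * i)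
    ≡⟨ solve 4 (λ c u v i → c :* (u :* i :+ v :* i) := c :* (u :+ v) :* i) refl (fromℕ (suc j)) (fromℕ u) (fromℕ v) i ⟩
  fromℕ (suc j) * (fromℕ u + fromℕ v) * i
    ≡⟨ cong (λ x → fromℕ (suc j) * x * i) (fromℕ-+ u v) ⟨
  fromℕ (suc j) * fromℕ (u ℕ.+ v) * i
    ≡⟨ cong (_* i) (fromℕ-* (suc j) (u ℕ.+ v)) ⟨
  fromℕ (suc j ℕ.* (u ℕ.+ v)) * i
    ≡⟨ cong₂ (λ x y → fromℕ x * y) (recurrence (suc j) (j !) (stirling m j) (stirling m (suc j)))
         (sym (factorialInverse-suc m)) ⟩
  fromℕ w * (fromℕ (suc m) * factorialInverse (suc m))
    ≡⟨ solve 3 (λ w s i → w :* (s :* i) := s :* (w :* i)) refl (fromℕ w) (fromℕ (suc m)) (factorialInverse (suc m)) ⟩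
  fromℕ (suc m) * (fromℕ w * factorialInverse (suc m)) ∎)
  where
  open ≡-Reasoning
  u v w : ℕ
  u = suc j ! ℕ.* stirling m (suc j)
  v = j ! ℕ.* stirling m j
  w = suc j ! ℕ.* stirling (suc m) (suc j)

  i : ℚ
  i = factorialInverse m

  recurrence : ∀ c f s s′ → c ℕ.* (c ℕ.* f ℕ.* s′ ℕ.+ f ℕ.* s) ≡ c ℕ.* f ℕ.* (s ℕ.+ c ℕ.* s′)
  recurrence = solve-∀

-- Accounts for the exponents k > m of x, which the sum in `_∘ₛ_`, cut off at `m`, does not produce.
stirling-zero : ∀ {m k} → m < k → stirling m k ≡ 0
stirling-zero {zero}  (s≤s _)   = refl
stirling-zero {suc m} {suc k} (s≤s m<k) = trans
  (cong₂ (λ x y → x ℕ.+ suc k ℕ.* y) (stirling-zero m<k) (stirling-zero (ℕ.m≤n⇒m≤1+n m<k)))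
  (ℕ.*-zeroʳ (suc k))

-- Coefficients of polynomials

coeff-+ : ∀ p q k → coeff (p +ₚ q) k ≡ coeff p k + coeff q k
coeff-+ []      q       k       = sym (ℚ.+-identityˡ (coeff q k))
coeff-+ (a ∷ p) []      k       = sym (ℚ.+-identityʳ (coeff (a ∷ p) k))
coeff-+ (a ∷ p) (b ∷ q) zero    = refl
coeff-+ (a ∷ p) (b ∷ q) (suc k) = coeff-+ p q k

coeff-· : ∀ a p k → coeff (a ·ₚ p) k ≡ a * coeff p k
coeff-· a []      k       = sym (ℚ.*-zeroʳ a)
coeff-· a (b ∷ p) zero    = refl
coeff-· a (b ∷ p) (suc k) = coeff-· a p k

coeff-* : ∀ p q → coeff (p *ₚ q) ≗ coeff p ⋆ coeff q
coeff-* []      q k = sym (∑-zero (suc k) λ i _ → ℚ.*-zeroˡ (coeff q (k ∸ i)))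
coeff-* (a ∷ p) q k = trans (coeff-+ (a ·ₚ q) (0ℚ ∷ (p *ₚ q)) k) (cong₂ _+_ (coeff-· a q k) (shifted k))
  where
  shifted : ∀ k → coeff (0ℚ ∷ (p *ₚ q)) k ≡ ∑ k (λ i → coeff p i * coeff q (k ∸ suc i))
  shifted zero    = refl
  shifted (suc k) = coeff-* p q k

coeff-sumₚ : ∀ (f : ℕ → Poly) n k → coeff (sumₚ (map f (upTo n))) k ≡ ∑ n (λ i → coeff (f i) k)
coeff-sumₚ f n k = trans (cong (λ ps → coeff (sumₚ ps) k) (List.map-upTo f n)) (go f n)
  where
  go : ∀ f n → coeff (sumₚ (applyUpTo f n)) k ≡ ∑ n (λ i → coeff (f i) k)
  go f zero    = refl
  go f (suc n) = trans (coeff-+ (f 0) _ k) (cong (coeff (f 0) k +_) (go (f ∘ suc) n))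

-- Each coefficient in t of (x(eᵗ - 1))ʲ is a rational multiple of xʲ, which reduces the calculation
-- in two variables to the sequences `power j`. As a record it allows `k` and `a` to be inferred
-- from a proof.
record Monomial (k : ℕ) (a : ℚ) (p : Poly) : Set where
  constructor monomial
  field coefficient : coeff p ≗ single k a

open Monomial

monomial-const : ∀ a → Monomial 0 a (const a)
monomial-const a = monomial λ { zero → refl ; (suc _) → refl }

monomial-X : Monomial 1 1ℚ X
monomial-X = monomial λ { zero → refl ; (suc zero) → refl ; (suc (suc _)) → refl }

monomial-* : ∀ {i j a b p q} → Monomial i a p → Monomial j b q → Monomial (i ℕ.+ j) (a * b) (p *ₚ q)
monomial-* {i} {j} {a} {b} {p} {q} mp mq = monomial λ k → trans (coeff-* p q k)
  (trans (⋆-cong (coefficient mp) (coefficient mq) k) (single-⋆-single i j a b k))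

∑-single-+ : ∀ n j (c : ℕ → ℚ) k → ∑ n (λ i → single j (c i) k) ≡ single j (∑ n c) k
∑-single-+ zero    j c k = sym (single-0 j k)
∑-single-+ (suc n) j c k = trans (cong (single j (c 0) k +_) (∑-single-+ n j (c ∘ suc) k))
  (single-+ j (c 0) (∑ n (c ∘ suc)) k)

monomial-expₛ-1 : ∀ m → Monomial 0 (expMinus1 m) ((expₛ -ₛ 1ₛ) m)
monomial-expₛ-1 zero    = monomial λ { zero → refl ; (suc _) → refl }
monomial-expₛ-1 (suc m) = monomial-const (factorialInverse (suc m))

-- Powers of x(eᵗ - 1) and the coefficients of the Touchard polynomials

block : Series
block = X ·ₛ (expₛ -ₛ 1ₛ)

monomial-block : ∀ m → Monomial 1 (expMinus1 m) (block m)
monomial-block m = subst (λ a → Monomial 1 a (block m)) (ℚ.*-identityˡ (expMinus1 m))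
  (monomial-* monomial-X (monomial-expₛ-1 m))

monomial-block^ : ∀ j m → Monomial j (power j m) ((block ^ₛ j) m)
monomial-block^ zero    zero    = monomial-const 1ℚ
monomial-block^ zero    (suc m) = monomial λ k → sym (single-0 0 k)
monomial-block^ (suc j) m       = monomial λ k → begin
  coeff ((block *ₛ (block ^ₛ j)) m) k
    ≡⟨ coeff-sumₚ (λ i → block i *ₚ (block ^ₛ j) (m ∸ i)) (suc m) k ⟩
  ∑ (suc m) (λ i → coeff (block i *ₚ (block ^ₛ j) (m ∸ i)) k)
    ≡⟨ ∑-cong (suc m) (λ i → coefficient (monomial-* (monomial-block i) (monomial-block^ j (m ∸ i))) k) ⟩
  ∑ (suc m) (λ i → single (suc j) (expMinus1 i * power j (m ∸ i)) k)
    ≡⟨ ∑-single-+ (suc m) (suc j) (λ i → expMinus1 i * power j (m ∸ i)) k ⟩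
  single (suc j) (power (suc j) m) k ∎
  where open ≡-Reasoning

-- The j-th term of the composition is a multiple of xʲ, so only j = k contributes to the
-- coefficient of xᵏ; there the k! of `power-stirling` cancels against the coefficient 1/k! of the
-- outer exponential, and the m! of `touchard` against 1/m!.
coeff-touchard : ∀ m k → coeff (touchard m) k ≡ fromℕ (stirling m k)
coeff-touchard m k = begin
  coeff (touchard m) k
    ≡⟨ coeff-· (fromℕ (m !)) (touchardEGF m) k ⟩
  fromℕ (m !) * coeff (touchardEGF m) k
    ≡⟨ cong (fromℕ (m !) *_) (coeff-sumₚ (λ j → expₛ j *ₚ (block ^ₛ j) m) (suc m) k) ⟩
  fromℕ (m !) * ∑ (suc m) (λ j → coeff (expₛ j *ₚ (block ^ₛ j) m) k)
    ≡⟨ cong (fromℕ (m !) *_) (∑-cong (suc m) term) ⟩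
  fromℕ (m !) * ∑ (suc m) (λ j → single j (fromℕ (stirling m j) * factorialInverse m) k)
    ≡⟨ cong (fromℕ (m !) *_) diagonal ⟩
  fromℕ (m !) * (fromℕ (stirling m k) * factorialInverse m)
    ≡⟨ solve 3 (λ f s i → f :* (s :* i) := s :* (f :* i)) refl (fromℕ (m !)) (fromℕ (stirling m k)) (factorialInverse m) ⟩
  fromℕ (stirling m k) * (fromℕ (m !) * factorialInverse m)
    ≡⟨ cong (fromℕ (stirling m k) *_) (factorialInverse-! m) ⟩
  fromℕ (stirling m k) * 1ℚ
    ≡⟨ ℚ.*-identityʳ (fromℕ (stirling m k)) ⟩
  fromℕ (stirling m k) ∎
  where
  open ≡-Reasoning

  value : ∀ j → factorialInverse j * power j m ≡ fromℕ (stirling m j) * factorialInverse m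
  value j = begin
    i * power j m
      ≡⟨ cong (i *_) (power-stirling j m) ⟩
    i * (fromℕ (j ! ℕ.* stirling m j) * factorialInverse m)
      ≡⟨ cong (λ x → i * (x * factorialInverse m)) (fromℕ-* (j !) (stirling m j)) ⟩
    i * (fromℕ (j !) * fromℕ (stirling m j) * factorialInverse m)
      ≡⟨ solve 4 (λ i f s t → i :* (f :* s :* t) := f :* i :* (s :* t)) refl
           i (fromℕ (j !)) (fromℕ (stirling m j)) (factorialInverse m) ⟩
    fromℕ (j !) * i * (fromℕ (stirling m j) * factorialInverse m)
      ≡⟨ cong (_* (fromℕ (stirling m j) * factorialInverse m)) (factorialInverse-! j) ⟩
    1ℚ * (fromℕ (stirling m j) * factorialInverse m)
      ≡⟨ ℚ.*-identityˡ (fromℕ (stirling m j) * factorialInverse m) ⟩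
    fromℕ (stirling m j) * factorialInverse m ∎
    where
    i : ℚ
    i = factorialInverse j

  term : ∀ j → coeff (expₛ j *ₚ (block ^ₛ j) m) k ≡ single j (fromℕ (stirling m j) * factorialInverse m) k
  term j = trans
    (coefficient (monomial-* (monomial-const (factorialInverse j)) (monomial-block^ j m)) k)
    (cong (λ a → single j a k) (value j))

  diagonal : ∑ (suc m) (λ j → single j (fromℕ (stirling m j) * factorialInverse m) k) ≡
             fromℕ (stirling m k) * factorialInverse m
  diagonal with k ℕ.<? suc m
  ... | yes k<1+m = trans
    (∑-single (suc m) k {λ j → single j (fromℕ (stirling m j) * factorialInverse m) k} k<1+m
      λ j j≢k → single-≢ j _ k j≢k)
    (single-refl k _)
  ... | no  k≮1+m = trans
    (∑-zero (suc m) {λ j → single j (fromℕ (stirling m j) * factorialInverse m) k} λ j j<1+m → single-≢ j _ k λ { refl → k≮1+m j<1+m })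
    (sym (trans (cong (λ s → fromℕ s * factorialInverse m) (stirling-zero (ℕ.≮⇒≥ k≮1+m)))
                (ℚ.*-zeroˡ (factorialInverse m))))

-- Each step of Horner's scheme multiplies what follows by `cX`, so that the coefficient in position
-- `k` collects `k` factors `c`.
coeff-∘-scale : ∀ c p k → coeff (p ∘ₚ (fromℕ c ·ₚ X)) k ≡ fromℕ (c ℕ.^ k) * coeff p k
coeff-∘-scale c []      k = sym (ℚ.*-zeroʳ (fromℕ (c ℕ.^ k)))
coeff-∘-scale c (a ∷ p) k = trans (coeff-+ (const a) (cX *ₚ (p ∘ₚ cX)) k)
  (trans (cong (coeff (const a) k +_) (trans (coeff-* cX (p ∘ₚ cX) k) (⋆-cong {b = s} (coefficient monomial-cX) (λ _ → refl) k))) (go k))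
  where
  cX : Poly
  cX = fromℕ c ·ₚ X

  s : ℕ → ℚ
  s = coeff (p ∘ₚ cX)

  monomial-cX : Monomial 1 (fromℕ c) cX
  monomial-cX = monomial λ k → trans (coeff-· (fromℕ c) X k) (trans (cong (fromℕ c *_) (coefficient monomial-X k))
    (trans (single-* 1 (fromℕ c) 1ℚ k) (cong (λ a → single 1 a k) (ℚ.*-identityʳ (fromℕ c)))))

  go : ∀ k → coeff (const a) k + (single 1 (fromℕ c) ⋆ s) k ≡ fromℕ (c ℕ.^ k) * coeff (a ∷ p) k
  go zero    = solve 2 (λ a s → a :+ (con 0ℚ :* s :+ con 0ℚ) := con 1ℚ :* a) refl a (s 0)
  go (suc k) = begin
    0ℚ + (single 1 (fromℕ c) ⋆ s) (suc k)         ≡⟨ ℚ.+-identityˡ ((single 1 (fromℕ c) ⋆ s) (suc k)) ⟩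
    (single 1 (fromℕ c) ⋆ s) (suc k)              ≡⟨ single₊-⋆-suc 0 (fromℕ c) s k ⟩
    (single 0 (fromℕ c) ⋆ s) k                    ≡⟨ single₀-⋆ (fromℕ c) s k ⟩
    fromℕ c * s k                                 ≡⟨ cong (fromℕ c *_) (coeff-∘-scale c p k) ⟩
    fromℕ c * (fromℕ (c ℕ.^ k) * coeff p k)       ≡⟨ ℚ.*-assoc (fromℕ c) (fromℕ (c ℕ.^ k)) (coeff p k) ⟨
    fromℕ c * fromℕ (c ℕ.^ k) * coeff p k         ≡⟨ cong (_* coeff p k) (fromℕ-* c (c ℕ.^ k)) ⟨
    fromℕ (c ℕ.^ suc k) * coeff p k               ∎
    where open ≡-Reasoning

monomial-X^ : ∀ j → Monomial j 1ℚ (X ^ₚ j)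
monomial-X^ zero    = monomial-const 1ℚ
monomial-X^ (suc j) = monomial-* monomial-X (monomial-X^ j)

coeff-sum-X^ : ∀ {A : Set} (w : A → ℕ) (xs : List A) k →
               coeff (sumₚ (map (λ x → X ^ₚ w x) xs)) k ≡ fromℕ (length (filter (λ x → w x ℕ.≟ k) xs))
coeff-sum-X^ w []       k = refl
coeff-sum-X^ w (x ∷ xs) k = trans (coeff-+ (X ^ₚ w x) (sumₚ (map (λ x → X ^ₚ w x) xs)) k)
  (trans (cong₂ _+_ (coefficient (monomial-X^ (w x)) k) (coeff-sum-X^ w xs k)) go)
  where
  go : single (w x) 1ℚ k + fromℕ (length (filter (λ x → w x ℕ.≟ k) xs)) ≡
       fromℕ (length (filter (λ x → w x ℕ.≟ k) (x ∷ xs)))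
  go with w x ℕ.≟ k
  ... | yes w≡k = trans
    (cong (_+ fromℕ (length (filter (λ x → w x ℕ.≟ k) xs)))
      (trans (cong (λ j → single j 1ℚ k) w≡k) (single-refl k 1ℚ)))
    (trans (sym (fromℕ-suc (length (filter (λ x → w x ℕ.≟ k) xs))))
      (cong (fromℕ ∘ length) (sym (List.filter-accept (λ x → w x ℕ.≟ k) w≡k))))
  ... | no  w≢k = trans
    (cong (_+ fromℕ (length (filter (λ x → w x ℕ.≟ k) xs))) (single-≢ (w x) 1ℚ k w≢k))
    (trans (ℚ.+-identityˡ _)
      (cong (fromℕ ∘ length) (sym (List.filter-reject (λ x → w x ℕ.≟ k) w≢k))))

-- Evaluation

eval-+ : ∀ p q c → eval (p +ₚ q) c ≡ eval p c + eval q c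
eval-+ []      q       c = sym (ℚ.+-identityˡ (eval q c))
eval-+ (a ∷ p) []      c = sym (ℚ.+-identityʳ (eval (a ∷ p) c))
eval-+ (a ∷ p) (b ∷ q) c = trans (cong (λ x → a + b + c * x) (eval-+ p q c))
  (solve 5 (λ a b c x y → a :+ b :+ c :* (x :+ y) := (a :+ c :* x) :+ (b :+ c :* y)) refl a b c (eval p c) (eval q c))

eval-· : ∀ a p c → eval (a ·ₚ p) c ≡ a * eval p c
eval-· a []      c = sym (ℚ.*-zeroʳ a)
eval-· a (b ∷ p) c = trans (cong (λ x → a * b + c * x) (eval-· a p c))
  (solve 4 (λ a b c x → a :* b :+ c :* (a :* x) := a :* (b :+ c :* x)) refl a b c (eval p c))

eval-* : ∀ p q c → eval (p *ₚ q) c ≡ eval p c * eval q c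
eval-* []      q c = sym (ℚ.*-zeroˡ (eval q c))
eval-* (a ∷ p) q c = trans (eval-+ (a ·ₚ q) (0ℚ ∷ (p *ₚ q)) c)
  (trans (cong₂ (λ x y → x + (0ℚ + c * y)) (eval-· a q c) (eval-* p q c))
    (solve 4 (λ a c x y → a :* y :+ (con 0ℚ :+ c :* (x :* y)) := (a :+ c :* x) :* y) refl a c (eval p c) (eval q c)))

eval-∘ : ∀ p q c → eval (p ∘ₚ q) c ≡ eval p (eval q c)
eval-∘ []      q c = refl
eval-∘ (a ∷ p) q c = trans (eval-+ (const a) (q *ₚ (p ∘ₚ q)) c)
  (cong₂ _+_ (trans (cong (a +_) (ℚ.*-zeroʳ c)) (ℚ.+-identityʳ a))
    (trans (eval-* q (p ∘ₚ q) c) (cong (eval q c *_) (eval-∘ p q c))))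

-- Covers the trailing zeros by which lists that represent the same polynomial can differ.
eval-zero : ∀ p c → p ≈ₚ [] → eval p c ≡ 0ℚ
eval-zero []      c p≈0 = refl
eval-zero (a ∷ p) c p≈0 = trans (cong₂ (λ x y → x + c * y) (p≈0 0) (eval-zero p c (p≈0 ∘ suc)))
  (trans (ℚ.+-identityˡ (c * 0ℚ)) (ℚ.*-zeroʳ c))

eval-cong : ∀ p q c → p ≈ₚ q → eval p c ≡ eval q c
eval-cong []      q       c p≈q = sym (eval-zero q c λ k → sym (p≈q k))
eval-cong (a ∷ p) []      c p≈q = eval-zero (a ∷ p) c p≈q
eval-cong (a ∷ p) (b ∷ q) c p≈q = cong₂ (λ x y → x + c * y) (p≈q 0) (eval-cong p q c (p≈q ∘ suc))

eval-X^-1 : ∀ j → eval (X ^ₚ j) 1ℚ ≡ 1ℚ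
eval-X^-1 zero    = refl
eval-X^-1 (suc j) = trans (eval-* X (X ^ₚ j) 1ℚ) (cong (1ℚ *_) (eval-X^-1 j))

eval-sum-X^-1 : ∀ {A : Set} (w : A → ℕ) (xs : List A) →
                eval (sumₚ (map (λ x → X ^ₚ w x) xs)) 1ℚ ≡ fromℕ (length xs)
eval-sum-X^-1 w []       = refl
eval-sum-X^-1 w (x ∷ xs) = trans (eval-+ (X ^ₚ w x) (sumₚ (map (λ x → X ^ₚ w x) xs)) 1ℚ)
  (trans (cong₂ _+_ (eval-X^-1 (w x)) (eval-sum-X^-1 w xs)) (sym (fromℕ-suc (length xs))))

eval-scaled-X-1 : ∀ c → eval (c ·ₚ X) 1ℚ ≡ c
eval-scaled-X-1 c = trans (eval-· c X 1ℚ) (ℚ.*-identityʳ c)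

proposition6 : ∀ (n : ℕ) → 1 ≤ n →
    (𝒜[ n ] ≈ₚ touchard (n ∸ 1) ∘ₚ (fromℕ n ·ₚ X)) ×
    (fromℕ (length (enrichedTrees n)) ≡ eval (touchard (n ∸ 1)) (fromℕ n))
proposition6 n@(suc m) _ = weighted , (begin
  -- At x = 1 every tree has weight 1 and nx becomes n, so the number of trees follows from the
  -- weighted identity.
  fromℕ (length (enrichedTrees n))                  ≡⟨ eval-sum-X^-1 EnrichedTree.numBlocks (enrichedTrees n) ⟨
  eval 𝒜[ n ] 1ℚ                                    ≡⟨ eval-cong 𝒜[ n ] (touchard m ∘ₚ (fromℕ n ·ₚ X)) 1ℚ weighted ⟩
  eval (touchard m ∘ₚ (fromℕ n ·ₚ X)) 1ℚ            ≡⟨ eval-∘ (touchard m) (fromℕ n ·ₚ X) 1ℚ ⟩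
  eval (touchard m) (eval (fromℕ n ·ₚ X) 1ℚ)        ≡⟨ cong (eval (touchard m)) (eval-scaled-X-1 (fromℕ n)) ⟩
  eval (touchard m) (fromℕ n)                       ∎)
  where
  open ≡-Reasoning

  weighted : 𝒜[ n ] ≈ₚ touchard m ∘ₚ (fromℕ n ·ₚ X)
  weighted k = begin
    coeff 𝒜[ n ] k                                  ≡⟨ coeff-sum-X^ EnrichedTree.numBlocks (enrichedTrees n) k ⟩
    fromℕ (length (Counting.treesWith n k))         ≡⟨ cong fromℕ (length-treesWith m k) ⟩
    fromℕ (n ℕ.^ k ℕ.* stirling m k)                ≡⟨ fromℕ-* (n ℕ.^ k) (stirling m k) ⟩
    fromℕ (n ℕ.^ k) * fromℕ (stirling m k)          ≡⟨ cong (fromℕ (n ℕ.^ k) *_) (coeff-touchard m k) ⟨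
    fromℕ (n ℕ.^ k) * coeff (touchard m) k          ≡⟨ coeff-∘-scale n (touchard m) k ⟨
    coeff (touchard m ∘ₚ (fromℕ n ·ₚ X)) k          ∎
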